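{- Let $d \geq 3$ be an integer. There is a positive integer $n_0(d)$ such that for every integer $n \geq n_0(d)$ there exists an $n \times n$ magic square of $d^{\text{th}}$ powers.
   Context: An $n\times n$ magic square is an $n \times n$ array of pairwise distinct positive integers such that the sums of the entries in each of the $n$ rows, each of the $n$ columns, and each of the two main diagonals are all equal. A magic square of $d^{\text{th}}$ powers is a magic square all of whose entries are of the form $x^d$ with $x$ a positive integer. -}

module Defs where

open import Data.Nat using (ℕ; zero; suc; _+_; _^_; _<_)
open import Data.Fin using (Fin; zero; suc; opposite)
open import Data.Product using (Σ; _×_; _,_)
open import Relation.Binary.PropositionalEquality using (_≡_)

sumFin : (n : ℕ) → (Fin n → ℕ) → ℕ
sumFin zero    f = 0
sumFin (suc n) f = f zero + sumFin n (λ i → f (suc i))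

Square : ℕ → Set
Square n = Fin n → Fin n → ℕ

PairwiseDistinct : (n : ℕ) → Square n → Set
PairwiseDistinct n A = ∀ (i j k l : Fin n) → A i j ≡ A k l → (i ≡ k) × (j ≡ l)

AllPositive : (n : ℕ) → Square n → Set
AllPositive n A = ∀ (i j : Fin n) → 0 < A i j

MagicSums : (n : ℕ) → Square n → Set
MagicSums n A = Σ ℕ λ s →
    (∀ i → sumFin n (λ j → A i j) ≡ s)
  × (∀ j → sumFin n (λ i → A i j) ≡ s)
  × (sumFin n (λ i → A i i) ≡ s)
  × (sumFin n (λ i → A i (opposite i)) ≡ s)

IsMagicSquare : (n : ℕ) → Square n → Set
IsMagicSquare n A = PairwiseDistinct n A × AllPositive n A × MagicSums n A

IsMagicSquareOfPowers : (d n : ℕ) → Square n → Set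
IsMagicSquareOfPowers d n A =
  IsMagicSquare n A × (∀ (i j : Fin n) → Σ ℕ λ x → (0 < x) × (A i j ≡ x ^ d))

{-# OPTIONS --safe #-}
module Submission where

-- Over ℤ/μ consider the polynomials whose coefficients are the base μ digits of the row u, of the
-- column v and of a label (r, s). If μ has no small prime factor, any few of their values at small
-- points are independent and uniform along every row, column and diagonal of the (u, v)-array
-- (Lagrange interpolation). The d-th power of a number written with these values as digits is a sum
-- of functions of at most d of them, so it yields blocks of side μ^(d+1) with constant sums of d-th
-- powers along all lines, while distinct labels give disjoint blocks.
--
-- One further value selects a scaling factor 2^g. Since 2^d ≡ 1 mod 2^d - 1, an integer in the right
-- residue class is a sum of any prescribed, merely logarithmic, number of powers of 2^d; hence the
-- scaling factors can be chosen to give blocks over three different moduli the same mean.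
--
-- For the sides V₀, V₁, V₂ one arranges V₁ ≡ 1 mod V₀ and V₂ ≡ 1 mod 2 V₀ V₁. Then V₂ = V₁ + β V₀, so
-- V₀ V₁ × V₂ rectangles are cut into blocks of sides V₀ and V₁, and every large n is x V₂ + 2 y V₀ V₁:
-- an x V₂ square of V₂-blocks surrounded by y frames of width V₀ V₁. The label of a block is the
-- position of its corner, which makes all entries distinct. The moduli grow with n, so that there are
-- enough labels.

open import Defs
open import Data.Nat using (ℕ; _≤_; _<_)
open import Data.Product using (Σ; _×_; _,_; proj₁; proj₂)
open import Data.Fin using (Fin; zero; suc; toℕ)
open import Data.Fin.Patterns using (0F; 1F; 2F)
import Data.Fin.Properties as Fin
open import Data.Empty using (⊥-elim)
open import Relation.Nullary using (yes; no)
open import Relation.Binary.Definitions using (tri<; tri≈; tri>)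
open import Relation.Binary.PropositionalEquality
open import Function using (_∘_)

-- Finite sums, and sums of a prescribed number of powers.

module FiniteSums where

  open import Data.Nat
  open import Data.Nat.Properties
  open import Data.Nat.DivMod
  open import Data.Nat.Divisibility
  open import Data.Nat.Tactic.RingSolver using (solve-∀)

  Σ< : ℕ → (ℕ → ℕ) → ℕ
  Σ< zero    f = 0
  Σ< (suc n) f = f 0 + Σ< n (f ∘ suc)

  sumFin-toℕ : ∀ n (f : ℕ → ℕ) → sumFin n (f ∘ toℕ) ≡ Σ< n f
  sumFin-toℕ zero    f = refl
  sumFin-toℕ (suc n) f = cong (f 0 +_) (sumFin-toℕ n (f ∘ suc))

  sumFin-cong : ∀ n {f g : Fin n → ℕ} → (∀ i → f i ≡ g i) → sumFin n f ≡ sumFin n g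
  sumFin-cong zero    eq = refl
  sumFin-cong (suc n) eq = cong₂ _+_ (eq zero) (sumFin-cong n (eq ∘ suc))

  Σ<-cong : ∀ n {f g} → (∀ i → i < n → f i ≡ g i) → Σ< n f ≡ Σ< n g
  Σ<-cong zero    eq = refl
  Σ<-cong (suc n) eq = cong₂ _+_ (eq 0 z<s) (Σ<-cong n λ i i<n → eq (suc i) (s<s i<n))

  Σ<-ext : ∀ n {f g} → (∀ i → f i ≡ g i) → Σ< n f ≡ Σ< n g
  Σ<-ext n eq = Σ<-cong n λ i _ → eq i

  Σ<-const : ∀ n c → Σ< n (λ _ → c) ≡ n * c
  Σ<-const zero    c = refl
  Σ<-const (suc n) c = cong (c +_) (Σ<-const n c)

  Σ<-+ : ∀ n f g → Σ< n (λ i → f i + g i) ≡ Σ< n f + Σ< n g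
  Σ<-+ zero    f g = refl
  Σ<-+ (suc n) f g rewrite Σ<-+ n (f ∘ suc) (g ∘ suc) = lem (f 0) (g 0) _ _
    where lem : ∀ a b c d → a + b + (c + d) ≡ a + c + (b + d)
          lem = solve-∀

  Σ<-*ˡ : ∀ n c f → Σ< n (λ i → c * f i) ≡ c * Σ< n f
  Σ<-*ˡ zero    c f = sym (*-zeroʳ c)
  Σ<-*ˡ (suc n) c f rewrite Σ<-*ˡ n c (f ∘ suc) = sym (*-distribˡ-+ c (f 0) _)

  Σ<-*ʳ : ∀ n c f → Σ< n (λ i → f i * c) ≡ Σ< n f * c
  Σ<-*ʳ n c f = trans (Σ<-ext n λ i → *-comm (f i) c) (trans (Σ<-*ˡ n c f) (*-comm c _))

  Σ<-swap : ∀ m n (f : ℕ → ℕ → ℕ) → Σ< m (λ i → Σ< n (f i)) ≡ Σ< n (λ j → Σ< m (λ i → f i j))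
  Σ<-swap zero    n f = sym (trans (Σ<-const n 0) (*-zeroʳ n))
  Σ<-swap (suc m) n f = trans (cong (Σ< n (f 0) +_) (Σ<-swap m n (f ∘ suc)))
                              (sym (Σ<-+ n (f 0) _))

  Σ<-split : ∀ m n f → Σ< (m + n) f ≡ Σ< m f + Σ< n (λ i → f (m + i))
  Σ<-split zero    n f = refl
  Σ<-split (suc m) n f = trans (cong (f 0 +_) (Σ<-split m n (f ∘ suc))) (sym (+-assoc (f 0) _ _))

  Σ<-last : ∀ n f → Σ< (suc n) f ≡ Σ< n f + f n
  Σ<-last zero    f = +-comm (f 0) 0
  Σ<-last (suc n) f = trans (cong (f 0 +_) (Σ<-last n (f ∘ suc))) (sym (+-assoc (f 0) _ _))

  Σ<-product : ∀ n k f → Σ< (n * k) f ≡ Σ< n (λ q → Σ< k (λ r → f (r + q * k)))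
  Σ<-product zero    k f = refl
  Σ<-product (suc n) k f = trans (Σ<-split k (n * k) f) (cong₂ _+_
    (Σ<-ext k λ r → cong f (sym (+-identityʳ r)))
    (trans (Σ<-product n k (λ i → f (k + i)))
           (Σ<-ext n λ q → Σ<-ext k λ r → cong f (lem k r (q * k)))))
    where lem : ∀ k r x → k + (r + x) ≡ r + (k + x)
          lem = solve-∀

  Σ<-≤ : ∀ n f c → (∀ i → f i ≤ c) → Σ< n f ≤ n * c
  Σ<-≤ zero    f c le = z≤n
  Σ<-≤ (suc n) f c le = +-mono-≤ (le 0) (Σ<-≤ n (f ∘ suc) c (le ∘ suc))

  Σ<-≥ : ∀ n f c → (∀ i → c ≤ f i) → n * c ≤ Σ< n f
  Σ<-≥ zero    f c le = z≤n
  Σ<-≥ (suc n) f c le = +-mono-≤ (le 0) (Σ<-≥ n (f ∘ suc) c (le ∘ suc))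

  -- Congruence to 1 modulo `e`; the natural quotient also makes `x` positive.
  One : ℕ → ℕ → Set
  One e x = Σ ℕ λ q → x ≡ 1 + e * q

  One-* : ∀ e {x y} → One e x → One e y → One e (x * y)
  One-* e (p , refl) (q , refl) = p + q + e * p * q , lem e p q
    where lem : ∀ e p q → (1 + e * p) * (1 + e * q) ≡ 1 + e * (p + q + e * p * q)
          lem = solve-∀

  One-^ : ∀ e {x} n → One e x → One e (x ^ n)
  One-^ e zero    _ = 0 , cong suc (sym (*-zeroʳ e))
  One-^ e (suc n) o = One-* e o (One-^ e n o)

  Σ<-One : ∀ e n f → (∀ i → One e (f i)) → Σ ℕ λ q → Σ< n f ≡ n + e * q
  Σ<-One e zero    f o = 0 , sym (*-zeroʳ e)
  Σ<-One e (suc n) f o with o 0 | Σ<-One e n (f ∘ suc) (o ∘ suc)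
  ... | p , eq | q , eq′ rewrite eq | eq′ = p + q , lem e n p q
    where lem : ∀ e n p q → 1 + e * p + (n + e * q) ≡ suc n + e * (p + q)
          lem = solve-∀

  ^-distribʳ-* : ∀ n x y → (x * y) ^ n ≡ x ^ n * y ^ n
  ^-distribʳ-* zero    x y = refl
  ^-distribʳ-* (suc n) x y rewrite ^-distribʳ-* n x y = lem x y (x ^ n) (y ^ n)
    where lem : ∀ x y p q → x * y * (p * q) ≡ x * p * (y * q)
          lem = solve-∀

  append : {A : Set} → ℕ → (f g : ℕ → A) → ℕ → A
  append zero    f g i       = g i
  append (suc a) f g zero    = f 0
  append (suc a) f g (suc i) = append a (f ∘ suc) g i

  Σ<-append : ∀ {A : Set} (φ : A → ℕ) a n f g →
    Σ< (a + n) (φ ∘ append a f g) ≡ Σ< a (φ ∘ f) + Σ< n (φ ∘ g)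
  Σ<-append φ zero    n f g = refl
  Σ<-append φ (suc a) n f g = trans (cong (φ (f 0) +_) (Σ<-append φ a n (f ∘ suc) g))
                                    (sym (+-assoc (φ (f 0)) _ _))

  -- Breaking one power b^(g+1) into b copies of b^g raises the number of summands by e = b - 1,
  -- so starting from the base b digits any larger count in the right class modulo e is reached.
  sum-of-powers : ∀ e L N y p q → N < suc e ^ L → e * L ≤ y → y ≤ N → N + e * p ≡ y + e * q →
    Σ (ℕ → ℕ) λ g → Σ< y (λ u → suc e ^ g u) ≡ N
  sum-of-powers e zero N y p q N<1 _ y≤N _ with n<1⇒n≡0 N<1
  ... | refl with n≤0⇒n≡0 y≤N
  ... | refl = (λ _ → 0) , refl
  sum-of-powers e (suc L) N y p q N< eL≤y y≤N eq = go (y′ ≤? N′)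
    where
    b = suc e
    a = N % b
    N′ = N / b
    y′ = y ∸ a

    N≡ : N ≡ a + N′ * b
    N≡ = m≡m%n+[m/n]*n N b

    a≤e : a ≤ e
    a≤e = ≤-pred (m%n<n N b)

    a+eL≤y : a + e * L ≤ y
    a+eL≤y = ≤-trans (≤-trans (+-monoˡ-≤ (e * L) a≤e) (≤-reflexive (sym (*-suc e L)))) eL≤y

    y≡ : y ≡ a + y′
    y≡ = sym (m+[n∸m]≡n (≤-trans (m≤m+n a (e * L)) a+eL≤y))

    eL≤y′ : e * L ≤ y′
    eL≤y′ = +-cancelˡ-≤ a _ _ (≤-trans a+eL≤y (≤-reflexive y≡))

    -- As `b` is 1 modulo `e`, `N` is congruent to `a + N′`, so the congruence passes from `N` and
    -- `y` to `N′` and `y′`.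
    eq′ : N′ + e * (N′ + p) ≡ y′ + e * q
    eq′ = +-cancelˡ-≡ a _ _ (trans (lem a N′ e p) (trans (cong (_+ e * p) (sym N≡))
            (trans eq (trans (cong (_+ e * q) y≡) (+-assoc a y′ _)))))
      where lem : ∀ a N′ e p → a + (N′ + e * (N′ + p)) ≡ a + N′ * suc e + e * p
            lem = solve-∀

    N′< : N′ < b ^ L
    N′< = m<n*o⇒m/o<n (subst (N <_) (*-comm b (b ^ L)) N<)

    go : _ → _
    -- The last digit contributes `a` summands `b ^ 0`; the summands found for `N′` have their
    -- exponents raised by one.
    go (yes y′≤N′) with sum-of-powers e L N′ y′ (N′ + p) q N′< eL≤y′ y′≤N′ eq′
    ... | g , Σg = append a (λ _ → 0) (suc ∘ g) , (begin
      Σ< y (λ u → b ^ append a (λ _ → 0) (suc ∘ g) u)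
        ≡⟨ cong (λ n → Σ< n (λ u → b ^ append a (λ _ → 0) (suc ∘ g) u)) y≡ ⟩
      Σ< (a + y′) (λ u → b ^ append a (λ _ → 0) (suc ∘ g) u)
        ≡⟨ Σ<-append (b ^_) a y′ _ _ ⟩
      Σ< a (λ _ → 1) + Σ< y′ (λ u → b * b ^ g u)
        ≡⟨ cong₂ _+_ (trans (Σ<-const a 1) (*-identityʳ a)) (trans (Σ<-*ˡ y′ b _) (cong (b *_) Σg)) ⟩
      a + b * N′
        ≡⟨ cong (a +_) (*-comm b N′) ⟩
      a + N′ * b
        ≡⟨ sym N≡ ⟩
      N ∎)
      where open ≡-Reasoning
    -- Now `N` is first taken as `a` ones and `N′` copies of `b`; breaking `j` of these copies into
    -- ones supplies the missing `y′ ∸ N′ = j * e` summands.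
    go (no y′≰N′) = append h (λ _ → 1) (λ _ → 0) , (begin
      Σ< y (λ u → b ^ append h (λ _ → 1) (λ _ → 0) u)
        ≡⟨ cong (λ n → Σ< n (λ u → b ^ append h (λ _ → 1) (λ _ → 0) u)) y≡′ ⟩
      Σ< (h + (a + j + j * e)) (λ u → b ^ append h (λ _ → 1) (λ _ → 0) u)
        ≡⟨ Σ<-append (b ^_) h _ _ _ ⟩
      Σ< h (λ _ → b * 1) + Σ< (a + j + j * e) (λ _ → 1)
        ≡⟨ cong₂ _+_ (Σ<-const h (b * 1)) (Σ<-const (a + j + j * e) 1) ⟩
      h * (b * 1) + (a + j + j * e) * 1
        ≡⟨ lem h a j e ⟩
      a + (h + j) * b
        ≡⟨ cong (λ x → a + x * b) h+j≡ ⟩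
      a + N′ * b
        ≡⟨ sym N≡ ⟩
      N ∎)
      where
      open ≡-Reasoning
      lem : ∀ h a j e → h * (suc e * 1) + (a + j + j * e) * 1 ≡ a + (h + j) * suc e
      lem = solve-∀
      k = y′ ∸ N′
      N′<y′ = ≰⇒> y′≰N′
      y′≡ : y′ ≡ N′ + k
      y′≡ = sym (m+[n∸m]≡n (<⇒≤ N′<y′))
      k>0 : 0 < k
      k>0 = m<n⇒0<n∸m N′<y′
      e∣k : e ∣ k
      e∣k = ∣m+n∣m⇒∣n {e} {e * q} {k} (divides (N′ + p) (sym (trans (*-comm (N′ + p) e)
              (+-cancelˡ-≡ N′ _ _ (trans eq′ (trans (cong (_+ e * q) y′≡)
                (trans (+-assoc N′ k _) (cong (N′ +_) (+-comm k _)))))))))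
              (m∣m*n q)
      j = quotient e∣k
      k≡ : k ≡ j * e
      k≡ = _∣_.equality e∣k
      e≢0 : e ≢ 0
      e≢0 e≡0 = n≮0 (subst (0 <_) (trans k≡ (trans (cong (j *_) e≡0) (*-zeroʳ j))) k>0)
      -- The bound `y ≤ N` ensures that there are `j` copies of `b` to break.
      je≤N′e : j * e ≤ N′ * e
      je≤N′e = +-cancelˡ-≤ (a + N′) _ _ (subst₂ _≤_
        (trans y≡ (trans (cong (a +_) (trans y′≡ (cong (N′ +_) k≡))) (sym (+-assoc a N′ _))))
        (trans N≡ (lem₂ a N′ e)) y≤N)
        where
        lem₂ : ∀ a n e → a + n * suc e ≡ a + n + n * e
        lem₂ = solve-∀
      j≤N′ : j ≤ N′
      j≤N′ = *-cancelʳ-≤ j N′ e {{≢-nonZero e≢0}} je≤N′e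
      h = N′ ∸ j
      h+j≡ : h + j ≡ N′
      h+j≡ = m∸n+n≡m j≤N′
      y≡′ : y ≡ h + (a + j + j * e)
      y≡′ = trans y≡ (trans (cong (a +_) (trans y′≡ (cong₂ _+_ (sym h+j≡) k≡))) (lem₃ a h j (j * e)))
        where lem₃ : ∀ a h j x → a + (h + j + x) ≡ h + (a + j + x)
              lem₃ = solve-∀

-- Tilings of rectangles by magic blocks.

module Geometry where

  open import Data.Nat
  open import Data.Nat.Properties
  open import Data.Nat.Tactic.RingSolver using (solve-∀)
  open FiniteSums

  -- All kinds share `τ`, the mean of the powers along a line. Line sums proportional to the side
  -- survive gluing, whichever kinds are mixed.
  module Tilings
    (Tag : Set) (V : Tag → ℕ) (d τ : ℕ)
    -- block i r c is the V i × V i block of kind i with upper left corner at row r, column c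
    (block : Tag → (r c : ℕ) → (u v : ℕ) → ℕ)
    (block-row : ∀ i r c u → Σ< (V i) (λ v → block i r c u v ^ d) ≡ V i * τ)
    (block-col : ∀ i r c v → Σ< (V i) (λ u → block i r c u v ^ d) ≡ V i * τ)
    (block-diag : ∀ i r c → Σ< (V i) (λ u → block i r c u u ^ d) ≡ V i * τ)
    (block-anti : ∀ i r c → Σ< (V i) (λ u → block i r c u (V i ∸ suc u) ^ d) ≡ V i * τ)
    where

    -- Arrangements of blocks obtained by successive full cuts; `a` counts rows, `b` columns. The
    -- empty rectangles are where repetitions start.
    data Rect : ℕ → ℕ → Set where
      tile : ∀ i → Rect (V i) (V i)
      nilʰ : ∀ {a} → Rect a 0
      nilᵛ : ∀ {b} → Rect 0 b
      _∣ʰ_ : ∀ {a b b′} → Rect a b → Rect a b′ → Rect a (b + b′)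
      _∣ᵛ_ : ∀ {a a′ b} → Rect a b → Rect a′ b → Rect (a + a′) b

    -- `r` and `c` accumulate the absolute position of the corner, which is handed to `block` as its
    -- label. The value 0 occurs only for empty rectangles, which have no cells.
    entry : ∀ {a b} → Rect a b → (r c x y : ℕ) → ℕ
    entry (tile i) r c x y = block i r c x y
    entry nilʰ     r c x y = 0
    entry nilᵛ     r c x y = 0
    entry (_∣ʰ_ {b = b} A B) r c x y with y <? b
    ... | yes _ = entry A r c x y
    ... | no  _ = entry B r (c + b) x (y ∸ b)
    entry (_∣ᵛ_ {a = a} A B) r c x y with x <? a
    ... | yes _ = entry A r c x y
    ... | no  _ = entry B (r + a) c (x ∸ a) y

    entry-ʰˡ : ∀ {a b b′} (A : Rect a b) (B : Rect a b′) r c x y → y < b →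
      entry (A ∣ʰ B) r c x y ≡ entry A r c x y
    entry-ʰˡ {b = b} A B r c x y y<b with y <? b
    ... | yes _   = refl
    ... | no y≮b = ⊥-elim (y≮b y<b)

    entry-ʰʳ : ∀ {a b b′} (A : Rect a b) (B : Rect a b′) r c x y →
      entry (A ∣ʰ B) r c x (b + y) ≡ entry B r (c + b) x y
    entry-ʰʳ {b = b} A B r c x y with b + y <? b
    ... | yes b+y<b = ⊥-elim (m+n≮m b y b+y<b)
    ... | no _ = cong (entry B r (c + b) x) (m+n∸m≡n b y)

    entry-ᵛˡ : ∀ {a a′ b} (A : Rect a b) (B : Rect a′ b) r c x y → x < a →
      entry (A ∣ᵛ B) r c x y ≡ entry A r c x y
    entry-ᵛˡ {a = a} A B r c x y x<a with x <? a
    ... | yes _   = refl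
    ... | no x≮a = ⊥-elim (x≮a x<a)

    entry-ᵛʳ : ∀ {a a′ b} (A : Rect a b) (B : Rect a′ b) r c x y →
      entry (A ∣ᵛ B) r c (a + x) y ≡ entry B (r + a) c x y
    entry-ᵛʳ {a = a} A B r c x y with a + x <? a
    ... | yes a+x<a = ⊥-elim (m+n≮m a x a+x<a)
    ... | no _ = cong (λ z → entry B (r + a) c z y) (m+n∸m≡n a x)

    data Side (m : ℕ) : ℕ → Set where
      low  : ∀ {x} → x < m → Side m x
      high : ∀ x → Side m (m + x)

    side : ∀ m x → Side m x
    side m x with x <? m
    ... | yes x<m = low x<m
    ... | no  x≮m = subst (Side m) (m+[n∸m]≡n (≮⇒≥ x≮m)) (high (x ∸ m))

    row-sum : ∀ {a b} (A : Rect a b) r c x → x < a → Σ< b (λ y → entry A r c x y ^ d) ≡ b * τ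
    row-sum (tile i) r c x _ = block-row i r c x
    row-sum nilʰ     r c x _ = refl
    row-sum (_∣ʰ_ {b = b} {b′} A B) r c x x<a = begin
      Σ< (b + b′) (λ y → entry (A ∣ʰ B) r c x y ^ d)
        ≡⟨ Σ<-split b b′ _ ⟩
      Σ< b (λ y → entry (A ∣ʰ B) r c x y ^ d) + Σ< b′ (λ y → entry (A ∣ʰ B) r c x (b + y) ^ d)
        ≡⟨ cong₂ _+_ (Σ<-cong b λ y y<b → cong (_^ d) (entry-ʰˡ A B r c x y y<b))
                     (Σ<-ext b′ λ y → cong (_^ d) (entry-ʰʳ A B r c x y)) ⟩
      Σ< b (λ y → entry A r c x y ^ d) + Σ< b′ (λ y → entry B r (c + b) x y ^ d)
        ≡⟨ cong₂ _+_ (row-sum A r c x x<a) (row-sum B r (c + b) x x<a) ⟩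
      b * τ + b′ * τ
        ≡⟨ sym (*-distribʳ-+ τ b b′) ⟩
      (b + b′) * τ ∎
      where open ≡-Reasoning
    row-sum (_∣ᵛ_ {a} {b = b} A B) r c x x<a with side a x
    ... | low x<a₁ = trans (Σ<-ext b λ y → cong (_^ d) (entry-ᵛˡ A B r c x y x<a₁)) (row-sum A r c x x<a₁)
    ... | high x′ = trans (Σ<-ext b λ y → cong (_^ d) (entry-ᵛʳ A B r c x′ y))
                          (row-sum B (r + a) c x′ (+-cancelˡ-< a _ _ x<a))

    col-sum : ∀ {a b} (A : Rect a b) r c y → y < b → Σ< a (λ x → entry A r c x y ^ d) ≡ a * τ
    col-sum (tile i) r c y _ = block-col i r c y
    col-sum nilᵛ     r c y _ = refl
    col-sum (_∣ᵛ_ {a} {a′} A B) r c y y<b = begin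
      Σ< (a + a′) (λ x → entry (A ∣ᵛ B) r c x y ^ d)
        ≡⟨ Σ<-split a a′ _ ⟩
      Σ< a (λ x → entry (A ∣ᵛ B) r c x y ^ d) + Σ< a′ (λ x → entry (A ∣ᵛ B) r c (a + x) y ^ d)
        ≡⟨ cong₂ _+_ (Σ<-cong a λ x x<a → cong (_^ d) (entry-ᵛˡ A B r c x y x<a))
                     (Σ<-ext a′ λ x → cong (_^ d) (entry-ᵛʳ A B r c x y)) ⟩
      Σ< a (λ x → entry A r c x y ^ d) + Σ< a′ (λ x → entry B (r + a) c x y ^ d)
        ≡⟨ cong₂ _+_ (col-sum A r c y y<b) (col-sum B (r + a) c y y<b) ⟩
      a * τ + a′ * τ
        ≡⟨ sym (*-distribʳ-+ τ a a′) ⟩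
      (a + a′) * τ ∎
      where open ≡-Reasoning
    col-sum (_∣ʰ_ {a} {b = b} A B) r c y y<b with side b y
    ... | low y<b₁ = trans (Σ<-ext a λ x → cong (_^ d) (entry-ʰˡ A B r c x y y<b₁)) (col-sum A r c y y<b₁)
    ... | high y′ = trans (Σ<-ext a λ x → cong (_^ d) (entry-ʰʳ A B r c x y′))
                          (col-sum B r (c + b) y′ (+-cancelˡ-< b _ _ y<b))

    -- An absolute position is the corner of a block plus an offset in it. Recovering corner and
    -- offset from an entry therefore recovers its position.
    record Located (X Y z : ℕ) : Set where
      constructor located
      field
        {i} : Tag
        {r c u v} : ℕ
        u< : u < V i
        v< : v < V i
        row : r + u ≡ X
        col : c + v ≡ Y
        value : z ≡ block i r c u v

    locate : ∀ {a b} (A : Rect a b) r c x y → x < a → y < b → Located (r + x) (c + y) (entry A r c x y)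
    locate (tile i) r c x y x<a y<b = located x<a y<b refl refl refl
    locate (_∣ʰ_ {b = b} A B) r c x y x<a y<b with side b y
    ... | low y<b₁ = subst (Located _ _) (sym (entry-ʰˡ A B r c x y y<b₁)) (locate A r c x y x<a y<b₁)
    ... | high y′ = subst₂ (Located (r + x)) (+-assoc c b y′) (sym (entry-ʰʳ A B r c x y′))
                      (locate B r (c + b) x y′ x<a (+-cancelˡ-< b _ _ y<b))
    locate (_∣ᵛ_ {a} A B) r c x y x<a y<b with side a x
    ... | low x<a₁ = subst (Located _ _) (sym (entry-ᵛˡ A B r c x y x<a₁)) (locate A r c x y x<a₁ y<b)
    ... | high x′ = subst₂ (λ X → Located X (c + y)) (+-assoc r a x′) (sym (entry-ᵛʳ A B r c x′ y))
                      (locate B (r + a) c x′ y (+-cancelˡ-< a _ _ x<a) y<b)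

    -- Only the arrangement is transposed; each block keeps its orientation, which is harmless
    -- because its rows and columns have the same sums.
    transpose : ∀ {a b} → Rect a b → Rect b a
    transpose (tile i) = tile i
    transpose nilʰ     = nilᵛ
    transpose nilᵛ     = nilʰ
    transpose (A ∣ʰ B) = transpose A ∣ᵛ transpose B
    transpose (A ∣ᵛ B) = transpose A ∣ʰ transpose B

    repeatʰ : ∀ k {a b} → Rect a b → Rect a (k * b)
    repeatʰ zero    A = nilʰ
    repeatʰ (suc k) A = A ∣ʰ repeatʰ k A

    repeatᵛ : ∀ k {a b} → Rect a b → Rect (k * a) b
    repeatᵛ zero    A = nilᵛ
    repeatᵛ (suc k) A = A ∣ᵛ repeatᵛ k A

    -- The diagonal sums are demanded for every corner, because moving the square into a frame
    -- changes the labels and hence the entries.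
    record Magic (n : ℕ) : Set where
      field
        rect : Rect n n
        diag : ∀ r c → Σ< n (λ x → entry rect r c x x ^ d) ≡ n * τ
        anti : ∀ r c → Σ< n (λ x → entry rect r c x (n ∸ suc x) ^ d) ≡ n * τ
    open Magic public

    empty : Magic 0
    empty = record { rect = nilʰ ; diag = λ _ _ → refl ; anti = λ _ _ → refl }

    single : ∀ i → Magic (V i)
    single i = record { rect = tile i ; diag = block-diag i ; anti = block-anti i }

    -- Copies of `C` in the four corners carry both diagonals across the frame, so the strips `R`
    -- need only row and column sums.
    frame : ∀ {q s} → Magic q → Rect q s → Magic s → Magic (q + (s + q))
    frame {q} {s} C R M = record { rect = A ; diag = diagA ; anti = antiA }
      where
      n = q + (s + q)
      Cᵣ = rect C
      Rᵗ = transpose R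
      top = Cᵣ ∣ʰ (R ∣ʰ Cᵣ)
      mid = Rᵗ ∣ʰ (rect M ∣ʰ Rᵗ)
      below = mid ∣ᵛ top
      A = top ∣ᵛ below

      three : ∀ (f : ℕ → ℕ) → Σ< n f ≡ Σ< q f + (Σ< s (λ x → f (q + x)) + Σ< q (λ x → f (q + (s + x))))
      three f = trans (Σ<-split q (s + q) f) (cong (Σ< q f +_) (Σ<-split s q _))

      total : q * τ + (s * τ + q * τ) ≡ n * τ
      total = sym (trans (*-distribʳ-+ τ q (s + q)) (cong (q * τ +_) (*-distribʳ-+ τ s q)))

      lines : ∀ r c (g : ℕ → ℕ) (f₁ f₂ f₃ : ℕ → ℕ) →
        (∀ x → x < q → entry A r c x (g x) ≡ f₁ x) →
        (∀ x → x < s → entry A r c (q + x) (g (q + x)) ≡ f₂ x) →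
        (∀ x → x < q → entry A r c (q + (s + x)) (g (q + (s + x))) ≡ f₃ x) →
        Σ< q (λ x → f₁ x ^ d) ≡ q * τ → Σ< s (λ x → f₂ x ^ d) ≡ s * τ → Σ< q (λ x → f₃ x ^ d) ≡ q * τ →
        Σ< n (λ x → entry A r c x (g x) ^ d) ≡ n * τ
      lines r c g f₁ f₂ f₃ e₁ e₂ e₃ s₁ s₂ s₃ = trans (three _) (trans (cong₂ _+_
        (trans (Σ<-cong q λ x x< → cong (_^ d) (e₁ x x<)) s₁) (cong₂ _+_
        (trans (Σ<-cong s λ x x< → cong (_^ d) (e₂ x x<)) s₂)
        (trans (Σ<-cong q λ x x< → cong (_^ d) (e₃ x x<)) s₃))) total)

      diagA : ∀ r c → Σ< n (λ x → entry A r c x x ^ d) ≡ n * τ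
      diagA r c = lines r c (λ x → x) _ _ _
        (λ x x<q → trans (entry-ᵛˡ top below r c x x x<q) (entry-ʰˡ Cᵣ (R ∣ʰ Cᵣ) r c x x x<q))
        (λ x x<s → trans (entry-ᵛʳ top below r c x (q + x)) (trans (entry-ᵛˡ mid top (r + q) c x (q + x) x<s)
          (trans (entry-ʰʳ Rᵗ (rect M ∣ʰ Rᵗ) (r + q) c x x) (entry-ʰˡ (rect M) Rᵗ (r + q) (c + q) x x x<s))))
        (λ x x<q → trans (entry-ᵛʳ top below r c (s + x) (q + (s + x)))
          (trans (entry-ᵛʳ mid top (r + q) c x (q + (s + x)))
          (trans (entry-ʰʳ Cᵣ (R ∣ʰ Cᵣ) (r + q + s) c x (s + x)) (entry-ʰʳ R Cᵣ (r + q + s) (c + q) x x))))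
        (diag C r c) (diag M (r + q) (c + q)) (diag C (r + q + s) (c + q + s))

      reflect : ∀ {m x y} → suc x + y ≡ m → m ∸ suc x ≡ y
      reflect {x = x} {y} refl = m+n∸m≡n (suc x) y

      gap : ∀ {m x} → x < m → suc x + (m ∸ suc x) ≡ m
      gap x<m = m+[n∸m]≡n x<m

      gap< : ∀ {m x} → x < m → m ∸ suc x < m
      gap< {m} {x} x<m = ≤-trans (m≤n+m _ x) (≤-reflexive (trans (+-suc x _) (gap x<m)))

      antiA : ∀ r c → Σ< n (λ x → entry A r c x (n ∸ suc x) ^ d) ≡ n * τ
      antiA r c = lines r c (λ x → n ∸ suc x) _ _ _
        (λ x x<q → trans (cong (entry A r c x) (reflect {n} {x} {q + (s + (q ∸ suc x))} (eq₁ x x<q)))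
          (trans (entry-ᵛˡ top below r c x _ x<q) (trans (entry-ʰʳ Cᵣ (R ∣ʰ Cᵣ) r c x _) (entry-ʰʳ R Cᵣ r (c + q) x _))))
        (λ x x<s → trans (cong (entry A r c (q + x)) (reflect {n} {q + x} {q + (s ∸ suc x)} (eq₂ x x<s)))
          (trans (entry-ᵛʳ top below r c x _) (trans (entry-ᵛˡ mid top (r + q) c x _ x<s)
          (trans (entry-ʰʳ Rᵗ (rect M ∣ʰ Rᵗ) (r + q) c x _) (entry-ʰˡ (rect M) Rᵗ (r + q) (c + q) x _ (gap< x<s))))))
        (λ x x<q → trans (cong (entry A r c (q + (s + x))) (reflect {n} {q + (s + x)} {q ∸ suc x} (eq₃ x x<q)))
          (trans (entry-ᵛʳ top below r c (s + x) _)
          (trans (entry-ᵛʳ mid top (r + q) c x _) (entry-ʰˡ Cᵣ (R ∣ʰ Cᵣ) (r + q + s) c x _ (gap< x<q)))))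
        -- The antidiagonal meets the upper right corner, the centre and the lower left corner.
        (anti C r (c + q + s)) (anti M (r + q) (c + q)) (anti C (r + q + s) c)
        where
        lem₁ : ∀ x y q s → suc x + (q + (s + y)) ≡ q + (s + (suc x + y))
        lem₁ = solve-∀
        eq₁ : ∀ x → x < q → suc x + (q + (s + (q ∸ suc x))) ≡ n
        eq₁ x x<q = trans (lem₁ x (q ∸ suc x) q s) (cong (λ z → q + (s + z)) (gap x<q))
        lem₂ : ∀ x y q → suc (q + x) + (q + y) ≡ q + ((suc x + y) + q)
        lem₂ = solve-∀
        eq₂ : ∀ x → x < s → suc (q + x) + (q + (s ∸ suc x)) ≡ n
        eq₂ x x<s = trans (lem₂ x (s ∸ suc x) q) (cong (λ z → q + (z + q)) (gap x<s))
        lem₃ : ∀ x y q s → suc (q + (s + x)) + y ≡ q + (s + (suc x + y))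
        lem₃ = solve-∀
        eq₃ : ∀ x → x < q → suc (q + (s + x)) + (q ∸ suc x) ≡ n
        eq₃ x x<q = trans (lem₃ x (q ∸ suc x) q s) (cong (λ z → q + (s + z)) (gap x<q))

    -- Passing from `k` to `k + 2` by a frame keeps both diagonals on diagonals of whole blocks, for
    -- either parity.
    grid : ∀ i k → Magic (k * V i)
    grid i 0             = empty
    grid i 1             = subst Magic (sym (+-identityʳ (V i))) (single i)
    grid i (suc (suc k)) = subst Magic (cong (V i +_) (+-comm (k * V i) (V i)))
                             (frame (single i) (repeatʰ k (tile i)) (grid i k))

    -- Since V k = V j + β V i, a V i V j × V k rectangle is cut by squares of kinds i and j.
    layers : ∀ i j k β → V k ≡ V j + β * V i → ∀ x y → Magic (y * (V j * V i + V j * V i) + x * V k)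
    layers i j k β Vk≡ x y = proj₂ (go y)
      where
      Q = V j * V i
      P = V k
      QP : Rect Q P
      QP = subst (Rect Q) (sym Vk≡) (subst (λ z → Rect z (V j)) (*-comm (V i) (V j)) (repeatᵛ (V i) (tile j))
                              ∣ʰ repeatʰ β (repeatᵛ (V j) (tile i)))
      QQ = grid i (V j)
      shuffle : ∀ Q y s → Q + (y * (Q + Q) + s + Q) ≡ suc y * (Q + Q) + s
      shuffle = solve-∀
      -- Along with the square goes a strip of width `Q` fitting its side, lengthened by `QQ` at
      -- both ends for the next frame.
      go : ∀ y → Rect Q (y * (Q + Q) + x * P) × Magic (y * (Q + Q) + x * P)
      go zero    = repeatʰ x QP , grid k x
      go (suc y) with go y
      ... | R , M = subst (Rect Q) (shuffle Q y (x * P)) (rect QQ ∣ʰ (R ∣ʰ rect QQ))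
                  , subst Magic (shuffle Q y (x * P)) (frame QQ R M)

-- Evaluation of integer polynomials given by coefficient vectors.

module ReedSolomon where

  open import Data.Nat as ℕ using (suc; zero; _^_; _∸_; z≤n; s≤s; z<s)
  import Data.Nat.Properties as ℕ
  import Data.Nat.DivMod as ℕ
  import Data.Nat.Divisibility as ℕ
  open import Data.Nat.Divisibility using (_∣_; divides)
  import Data.Nat.Tactic.RingSolver as ℕSolver
  open import Data.Integer using (ℤ; +_; -[1+_]; 0ℤ; 1ℤ; _+_; _*_; _-_; -_)
  import Data.Integer.Properties as ℤ
  open import Data.Integer.DivMod using (_%ℕ_; _/ℕ_; a≡a%ℕn+[a/ℕn]*n; n%ℕd<d)
  open import Data.Integer.Tactic.RingSolver using (solve-∀)
  open import Data.List using (List; []; _∷_; length)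
  open import Data.List.Relation.Unary.All as All using (All; []; _∷_)
  open import Data.Vec using (Vec; []; _∷_; _++_; zipWith; replicate)
  import Data.Vec.Properties as Vec
  open import Data.Vec.Relation.Unary.All using ([]; _∷_) renaming (All to VAll)
  import Data.Vec.Relation.Unary.All.Properties as VAll
  open import Data.Vec.Relation.Binary.Pointwise.Inductive as PW using (Pointwise; []; _∷_)
  open FiniteSums

  ev : ∀ {a} → ℤ → Vec ℤ a → ℤ
  ev x []       = 0ℤ
  ev x (c ∷ cs) = c + x * ev x cs

  ev-+ : ∀ {a} x (v w : Vec ℤ a) → ev x (zipWith _+_ v w) ≡ ev x v + ev x w
  ev-+ x []       []       = refl
  ev-+ x (c ∷ v) (d ∷ w) rewrite ev-+ x v w = lem c d x (ev x v) (ev x w)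
    where lem : ∀ c d x p q → c + d + x * (p + q) ≡ c + x * p + (d + x * q)
          lem = solve-∀

  -- The coefficients, constant term first, of `c + (z - s) g(z)` as a polynomial in `z`.
  lin : ∀ {a} → ℤ → ℤ → Vec ℤ a → Vec ℤ (suc a)
  lin s c []      = c ∷ []
  lin s c (d ∷ g) = (c - s * d) ∷ lin s d g

  ev-lin : ∀ {a} x s c (g : Vec ℤ a) → ev x (lin s c g) ≡ c + (x - s) * ev x g
  ev-lin x s c []      = lem x s c
    where lem : ∀ x s c → c + x * 0ℤ ≡ c + (x - s) * 0ℤ
          lem = solve-∀
  ev-lin x s c (d ∷ g) rewrite ev-lin x s d g = lem x s c d (ev x g)
    where lem : ∀ x s c d p → c - s * d + x * (d + (x - s) * p) ≡ c + (x - s) * (d + x * p)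
          lem = solve-∀

  -- Synthetic division by the monic polynomial `z - s`, with remainder `c`.
  unlin : ∀ {a} s (p : Vec ℤ (suc a)) → Σ ℤ λ c → Σ (Vec ℤ a) λ g → p ≡ lin s c g
  unlin s (c ∷ [])    = c , [] , refl
  unlin s (c ∷ d ∷ p) with unlin s (d ∷ p)
  ... | c′ , g , eq = c + s * c′ , c′ ∷ g , cong₂ _∷_ (lem c s c′) eq
    where lem : ∀ c s d → c ≡ c + s * d - s * d
          lem = solve-∀

  -- Residues modulo `μ`, translation of digit vectors, interpolation.

  module Residues (X : ℕ) where

    μ : ℕ
    μ = suc X

    infix 4 _≈_
    record _≈_ (a b : ℤ) : Set where
      constructor by
      field
        multiple : ℤ
        equation : a ≡ b + multiple * + μ

    ≈-reflexive : ∀ {a b} → a ≡ b → a ≈ b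
    ≈-reflexive {a} refl = by 0ℤ (lem a (+ μ))
      where lem : ∀ a m → a ≡ a + 0ℤ * m
            lem = solve-∀

    ≈-refl : ∀ {a} → a ≈ a
    ≈-refl = ≈-reflexive refl

    ≈-sym : ∀ {a b} → a ≈ b → b ≈ a
    ≈-sym {a} {b} (by q refl) = by (- q) (lem b q (+ μ))
      where lem : ∀ b q m → b ≡ b + q * m + - q * m
            lem = solve-∀

    ≈-trans : ∀ {a b c} → a ≈ b → b ≈ c → a ≈ c
    ≈-trans {c = c} (by p refl) (by q refl) = by (p + q) (lem c p q (+ μ))
      where lem : ∀ c p q m → c + q * m + p * m ≡ c + (p + q) * m
            lem = solve-∀

    ≈-+ : ∀ {a b c d} → a ≈ b → c ≈ d → a + c ≈ b + d
    ≈-+ {b = b} {d = d} (by p refl) (by q refl) = by (p + q) (lem b d p q (+ μ))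
      where lem : ∀ b d p q m → b + p * m + (d + q * m) ≡ b + d + (p + q) * m
            lem = solve-∀

    ≈-*ˡ : ∀ x {a b} → a ≈ b → x * a ≈ x * b
    ≈-*ˡ x {b = b} (by p refl) = by (x * p) (lem x b p (+ μ))
      where lem : ∀ x b p m → x * (b + p * m) ≡ x * b + x * p * m
            lem = solve-∀

    residue-unique : ∀ {r s} → r < μ → s < μ → + r ≈ + s → r ≡ s
    residue-unique {r} {s} r<μ s<μ (by (+ zero) eq) =
      ℤ.+-injective (trans eq (trans (cong (λ y → + s + y) (ℤ.*-zeroˡ (+ μ))) (ℤ.+-identityʳ (+ s))))
    residue-unique {r} {s} r<μ s<μ (by (+ suc k) eq) = ⊥-elim (ℕ.<⇒≱ r<μ
      (subst (μ ≤_) (sym r≡) (ℕ.≤-trans (ℕ.m≤m+n μ _) (ℕ.m≤n+m (suc k ℕ.* μ) s))))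
      where r≡ : r ≡ s ℕ.+ suc k ℕ.* μ
            r≡ = ℤ.+-injective (trans eq (trans (cong (λ y → + s + y) (sym (ℤ.pos-* (suc k) μ)))
                   (sym (ℤ.pos-+ s (suc k ℕ.* μ)))))
    residue-unique {r} {s} r<μ s<μ (by -[1+ k ] eq) = ⊥-elim (ℕ.<⇒≱ s<μ
      (subst (μ ≤_) (sym s≡) (ℕ.≤-trans (ℕ.m≤m+n μ _) (ℕ.m≤n+m (suc k ℕ.* μ) r))))
      where
      lem : ∀ s q m → s ≡ s + - q * m + q * m
      lem = solve-∀
      s≡ : s ≡ r ℕ.+ suc k ℕ.* μ
      s≡ = ℤ.+-injective (trans (lem (+ s) (+ suc k) (+ μ)) (trans (cong (λ y → y + + suc k * + μ) (sym eq))
             (trans (cong (λ y → + r + y) (sym (ℤ.pos-* (suc k) μ))) (sym (ℤ.pos-+ r (suc k ℕ.* μ))))))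

    dg : ℤ → ℕ
    dg z = z %ℕ μ

    dg< : ∀ z → dg z < μ
    dg< z = n%ℕd<d z μ

    dg-≈ : ∀ z → z ≈ + dg z
    dg-≈ z = by (z /ℕ μ) (a≡a%ℕn+[a/ℕn]*n z μ)

    dg-cong : ∀ {a b} → a ≈ b → dg a ≡ dg b
    dg-cong {a} {b} a≈b = residue-unique (dg< a) (dg< b)
      (≈-trans (≈-sym (dg-≈ a)) (≈-trans a≈b (dg-≈ b)))

    dg-injective : ∀ {a b} → dg a ≡ dg b → a ≈ b
    dg-injective {a} {b} eq = ≈-trans (dg-≈ a) (≈-trans (≈-reflexive (cong +_ eq)) (≈-sym (dg-≈ b)))

    dg-small : ∀ {c} → c < μ → dg (+ c) ≡ c
    dg-small c<μ = ℕ.m<n⇒m%n≡m c<μ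

    Unit : ℤ → Set
    Unit z = Σ ℤ λ h → z * h ≈ 1ℤ

    Unit-cancel : ∀ z x → Unit z → z * x ≈ 0ℤ → x ≈ 0ℤ
    Unit-cancel z x (h , by q zh) (by p zx) = by (h * p - q * x) (begin
      x                                             ≡⟨ lem₁ x q (+ μ) ⟩
      x * (1ℤ + q * + μ) - q * x * + μ              ≡⟨ cong (λ y → x * y - q * x * + μ) (sym zh) ⟩
      x * (z * h) - q * x * + μ                     ≡⟨ lem₂ x z h (q * x * + μ) ⟩
      z * x * h - q * x * + μ                       ≡⟨ cong (λ y → y * h - q * x * + μ) zx ⟩
      (0ℤ + p * + μ) * h - q * x * + μ              ≡⟨ lem₃ p h q x (+ μ) ⟩
      0ℤ + (h * p - q * x) * + μ                    ∎)
      where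
      open ≡-Reasoning
      lem₁ : ∀ x q m → x ≡ x * (1ℤ + q * m) - q * x * m
      lem₁ = solve-∀
      lem₂ : ∀ x z h r → x * (z * h) - r ≡ z * x * h - r
      lem₂ = solve-∀
      lem₃ : ∀ p h q x m → (0ℤ + p * m) * h - q * x * m ≡ 0ℤ + (h * p - q * x) * m
      lem₃ = solve-∀

    Respects : (ℤ → ℕ) → Set
    Respects g = ∀ {a b} → a ≈ b → g a ≡ g b

    -- The shift only exchanges the term at 0 for the term at `μ`, and these agree.
    Σ<-shift-suc : ∀ g → Respects g → Σ< μ (λ c → g (+ suc c)) ≡ Σ< μ (λ c → g (+ c))
    Σ<-shift-suc g resp = ℕ.+-cancelˡ-≡ (g 0ℤ) _ _ (trans (Σ<-last μ (λ c → g (+ c)))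
      (trans (ℕ.+-comm _ (g (+ μ))) (cong (ℕ._+ Σ< μ (λ c → g (+ c))) (resp (by 1ℤ (lem (+ μ)))))))
      where lem : ∀ m → m ≡ 0ℤ + 1ℤ * m
            lem = solve-∀

    Σ<-shift-ℕ : ∀ g → Respects g → ∀ n → Σ< μ (λ c → g (+ c + + n)) ≡ Σ< μ (λ c → g (+ c))
    Σ<-shift-ℕ g resp zero    = Σ<-ext μ λ c → cong g (ℤ.+-identityʳ (+ c))
    Σ<-shift-ℕ g resp (suc n) = trans
      (Σ<-ext μ λ c → cong g (cong +_ (ℕ.+-suc c n)))
      (trans (Σ<-shift-suc (λ z → g (z + + n)) (λ a≈b → resp (≈-+ a≈b ≈-refl))) (Σ<-shift-ℕ g resp n))

    Σ<-shift : ∀ g → Respects g → ∀ s → Σ< μ (λ c → g (+ c + s)) ≡ Σ< μ (λ c → g (+ c))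
    Σ<-shift g resp (+ n)    = Σ<-shift-ℕ g resp n
    -- A shift up by `suc n`, applied to the function already shifted down, restores the original
    -- sum.
    Σ<-shift g resp -[1+ n ] = trans
      (sym (Σ<-shift-ℕ (λ z → g (z + -[1+ n ])) (λ a≈b → resp (≈-+ a≈b ≈-refl)) (suc n)))
      (Σ<-ext μ λ c → cong g (lem (+ c) (+ suc n)))
      where lem : ∀ c n → c + n + - n ≡ c
            lem = solve-∀

    digits : ∀ a → ℕ → Vec ℤ a
    digits zero    n = []
    digits (suc a) n = + (n ℕ.% μ) ∷ digits a (n ℕ./ μ)

    Σdigits-suc : ∀ a (F : Vec ℤ (suc a) → ℕ) →
      Σ< (μ ^ suc a) (F ∘ digits (suc a)) ≡ Σ< (μ ^ a) (λ q → Σ< μ (λ r → F (+ r ∷ digits a q)))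
    Σdigits-suc a F = begin
      Σ< (μ ℕ.* μ ^ a) (F ∘ digits (suc a))
        ≡⟨ cong (λ n → Σ< n (F ∘ digits (suc a))) (ℕ.*-comm μ (μ ^ a)) ⟩
      Σ< (μ ^ a ℕ.* μ) (F ∘ digits (suc a))
        ≡⟨ Σ<-product (μ ^ a) μ _ ⟩
      Σ< (μ ^ a) (λ q → Σ< μ (λ r → F (digits (suc a) (r ℕ.+ q ℕ.* μ))))
        ≡⟨ Σ<-ext (μ ^ a) (λ q → Σ<-cong μ λ r r<μ → cong F (cong₂ (λ c n → + c ∷ digits a n)
             (trans (ℕ.[m+kn]%n≡m%n r q μ) (ℕ.m<n⇒m%n≡m r<μ))
             (quot r q r<μ))) ⟩
      Σ< (μ ^ a) (λ q → Σ< μ (λ r → F (+ r ∷ digits a q))) ∎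
      where
      open ≡-Reasoning
      quot : ∀ r q → r < μ → (r ℕ.+ q ℕ.* μ) ℕ./ μ ≡ q
      quot r q r<μ = trans (ℕ.+-distrib-/-∣ʳ r (ℕ.divides-refl q)) (cong₂ ℕ._+_ (ℕ.m<n⇒m/n≡0 r<μ) (ℕ.m*n/n≡m q μ))

    RespectsV : ∀ {a} → (Vec ℤ a → ℕ) → Set
    RespectsV F = ∀ {v w} → Pointwise _≈_ v w → F v ≡ F w

    -- Below `μ ^ a` the digits run once through all residue vectors; translation permutes these,
    -- one coordinate at a time.
    Σdigits-shift : ∀ a (F : Vec ℤ a → ℕ) → RespectsV F → ∀ y →
      Σ< (μ ^ a) (λ n → F (zipWith _+_ (digits a n) y)) ≡ Σ< (μ ^ a) (F ∘ digits a)
    Σdigits-shift zero    F resp []      = refl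
    Σdigits-shift (suc a) F resp (c ∷ y) = begin
      Σ< (μ ^ suc a) (λ n → F (zipWith _+_ (digits (suc a) n) (c ∷ y)))
        ≡⟨ Σdigits-suc a (λ v → F (zipWith _+_ v (c ∷ y))) ⟩
      Σ< (μ ^ a) (λ q → Σ< μ (λ r → F ((+ r + c) ∷ zipWith _+_ (digits a q) y)))
        ≡⟨ Σ<-ext (μ ^ a) (λ q → Σ<-shift (λ z → F (z ∷ zipWith _+_ (digits a q) y))
             (λ a≈b → resp (a≈b ∷ PW.refl ≈-refl)) c) ⟩
      Σ< (μ ^ a) (λ q → Σ< μ (λ r → F (+ r ∷ zipWith _+_ (digits a q) y)))
        ≡⟨ Σdigits-shift a (λ v → Σ< μ (λ r → F (+ r ∷ v)))
             (λ v≈w → Σ<-ext μ λ r → resp (≈-refl {+ r} ∷ v≈w)) y ⟩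
      Σ< (μ ^ a) (λ q → Σ< μ (λ r → F (+ r ∷ digits a q)))
        ≡⟨ sym (Σdigits-suc a F) ⟩
      Σ< (μ ^ suc a) (F ∘ digits (suc a)) ∎
      where open ≡-Reasoning

    ev-cong : ∀ {a} x {v w : Vec ℤ a} → Pointwise _≈_ v w → ev x v ≈ ev x w
    ev-cong x []           = ≈-refl
    ev-cong x (c≈d ∷ v≈w) = ≈-+ c≈d (≈-*ˡ x (ev-cong x v≈w))

    module Evaluation {T : ℕ} (x : Fin T → ℤ) (diff : ∀ s t → s ≢ t → Unit (x s - x t)) where

      -- Newton interpolation: the quotient polynomial has to take the divided differences `c′` at
      -- the remaining points, and the differences of points are invertible.
      interpolate : ∀ a (S : List (Fin T)) → length S ≤ a → (c : Fin T → ℤ) →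
        Σ (Vec ℤ a) λ y → All (λ s → ev (x s) y ≈ c s) S
      interpolate a       []      _         c = replicate a 0ℤ , []
      interpolate (suc a) (s ∷ S) (s≤s S≤a) c = lin (x s) (c s) y , at-s ∷ All.map (λ {t} → at t) y-ok
        where
        c′ : Fin T → ℤ
        c′ t with t Fin.≟ s
        -- An arbitrary value: at `x s` the result is `c s` whatever the quotient is, so `S` may
        -- contain repetitions.
        ... | yes _  = 0ℤ
        ... | no t≢s = proj₁ (diff t s t≢s) * (c t - c s)

        IH = interpolate a S S≤a c′
        y = proj₁ IH
        y-ok = proj₂ IH

        at-s : ev (x s) (lin (x s) (c s) y) ≈ c s
        at-s = ≈-reflexive (trans (ev-lin (x s) (x s) (c s) y) (lem (c s) (x s) (ev (x s) y)))
          where lem : ∀ c x p → c + (x - x) * p ≡ c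
                lem = solve-∀

        at : ∀ t → ev (x t) y ≈ c′ t → ev (x t) (lin (x s) (c s) y) ≈ c t
        at t y≈ with t Fin.≟ s
        ... | yes refl = at-s
        ... | no t≢s = ≈-trans (≈-reflexive (ev-lin (x t) (x s) (c s) y))
            (≈-trans (≈-+ (≈-refl {c s}) (≈-*ˡ (x t - x s) y≈))
            (≈-trans (≈-reflexive (lem₁ (c s) (x t - x s) h (c t - c s)))
            (≈-trans (≈-+ (≈-refl {c s}) (≈-*ˡ (c t - c s) unit))
                     (≈-reflexive (lem₂ (c s) (c t))))))
          where
          h = proj₁ (diff t s t≢s)
          unit = proj₂ (diff t s t≢s)
          lem₁ : ∀ c u h v → c + u * (h * v) ≡ c + v * (u * h)
          lem₁ = solve-∀
          lem₂ : ∀ c d → c + (d - c) * 1ℤ ≡ d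
          lem₂ = solve-∀

    NullV : ∀ {a} → Vec ℤ a → Set
    NullV {a} v = Pointwise _≈_ v (replicate a 0ℤ)

    lin-null : ∀ {a} s {c} {g : Vec ℤ a} → c ≈ 0ℤ → NullV g → NullV (lin s c g)
    lin-null s {g = []}    c≈0 []          = c≈0 ∷ []
    lin-null s {c} {g = d ∷ g} c≈0 (d≈0 ∷ g≈0) =
      ≈-trans (≈-+ c≈0 (≈-trans (≈-reflexive (lem s d)) (≈-*ˡ (- s) d≈0))) (≈-reflexive (lem₂ s))
      ∷ lin-null s d≈0 g≈0
      where lem : ∀ s d → - (s * d) ≡ - s * d
            lem = solve-∀
            lem₂ : ∀ s → 0ℤ + - s * 0ℤ ≡ 0ℤ
            lem₂ = solve-∀

    -- `μ` need not be prime: linear factors are split off one by one, and their values at the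
    -- remaining roots are units, which cancel.
    roots-null : ∀ n (x : Fin n → ℤ) → (∀ s t → s ≢ t → Unit (x s - x t)) →
      (p : Vec ℤ n) → (∀ t → ev (x t) p ≈ 0ℤ) → NullV p
    roots-null zero    x diff []  roots = []
    roots-null (suc n) x diff p   roots with unlin (x zero) p
    ... | c , g , refl = lin-null (x zero) c≈0
        (roots-null n (x ∘ suc) (λ s t s≢t → diff (suc s) (suc t) (s≢t ∘ Fin.suc-injective)) g
          (λ t → Unit-cancel (x (suc t) - x zero) (ev (x (suc t)) g) (diff (suc t) zero λ ()) (rest t)))
      where
      lem : ∀ c x p → c ≡ c + (x - x) * p
      lem = solve-∀
      c≈0 : c ≈ 0ℤ
      c≈0 = ≈-trans (≈-reflexive (trans (lem c (x zero) (ev (x zero) g)) (sym (ev-lin (x zero) (x zero) c g)))) (roots zero)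
      lem₂ : ∀ c y → y ≡ c + y + - 1ℤ * c
      lem₂ = solve-∀
      rest : ∀ t → (x (suc t) - x zero) * ev (x (suc t)) g ≈ 0ℤ
      rest t = ≈-trans (≈-reflexive (trans (lem₂ c _) (cong (λ y → y + - 1ℤ * c) (sym (ev-lin (x (suc t)) (x zero) c g)))))
        (≈-+ (roots (suc t)) (≈-*ˡ (- 1ℤ) c≈0))

  -- Sums over cosets of a Reed-Solomon code.

  module Code (X T a : ℕ) (x : Fin (suc T) → ℤ)
    (diff : ∀ s t → s ≢ t → Residues.Unit X (x s - x t)) where

    open Residues X
    open Evaluation x diff

    Word : Set
    Word = Fin (suc T) → ℤ

    Units : Word → Set
    Units γ = ∀ t → Unit (γ t)

    -- A generalized Reed-Solomon code with multipliers `γ`, translated by `δ`; the digits of `n`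
    -- are the message.
    codeword : (γ δ : Word) → ℕ → Word
    codeword γ δ n t = δ t + γ t * ev (x t) (digits a n)

    codeSum : (γ δ : Word) → (Word → ℕ) → ℕ
    codeSum γ δ H = Σ< (μ ^ a) (λ n → H (codeword γ δ n))

    DependsOn : List (Fin (suc T)) → (Word → ℕ) → Set
    DependsOn S H = ∀ u v → All (λ s → u s ≈ v s) S → H u ≡ H v

    record Invariant (H : Word → ℕ) : Set where
      constructor invariant
      field
        translate : ∀ γ → Units γ → ∀ δ δ′ → codeSum γ δ H ≡ codeSum γ δ′ H
    open Invariant

    -- By interpolation `δ - δ′` agrees on `S` with a codeword, and adding a fixed message to all
    -- messages permutes them.
    dependsOn⇒invariant : ∀ S H → length S ≤ a → DependsOn S H → Invariant H
    dependsOn⇒invariant S H S≤a dep = invariant λ γ unit δ δ′ → proof γ unit δ δ′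
      where
      open ≡-Reasoning
      proof : ∀ γ → Units γ → ∀ δ δ′ → codeSum γ δ H ≡ codeSum γ δ′ H
      proof γ unit δ δ′ = begin
        codeSum γ δ H
          ≡⟨ Σ<-ext (μ ^ a) (λ n → dep _ _ (All.map (λ {s} → at n s) y-ok)) ⟩
        Σ< (μ ^ a) (λ n → F (zipWith _+_ (digits a n) y))
          ≡⟨ Σdigits-shift a F (λ {v} {w} v≈w → dep _ _ (All.universal
               (λ s → ≈-+ (≈-refl {δ′ s}) (≈-*ˡ (γ s) (ev-cong (x s) v≈w))) S)) y ⟩
        codeSum γ δ′ H ∎
        where
        F : Vec ℤ a → ℕ
        F v = H (λ t → δ′ t + γ t * ev (x t) v)
        I = interpolate a S S≤a (λ t → proj₁ (unit t) * (δ t - δ′ t))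
        y = proj₁ I
        y-ok = proj₂ I
        lem₁ : ∀ d d′ g e → d + g * e ≡ d′ + g * e + (d - d′) * 1ℤ
        lem₁ = solve-∀
        lem₂ : ∀ d d′ g e h → d′ + g * e + (d - d′) * (g * h) ≡ d′ + g * e + g * (h * (d - d′))
        lem₂ = solve-∀
        lem₃ : ∀ d′ g e f → d′ + g * e + g * f ≡ d′ + g * (e + f)
        lem₃ = solve-∀
        at : ∀ n s → ev (x s) y ≈ proj₁ (unit s) * (δ s - δ′ s) →
          codeword γ δ n s ≈ δ′ s + γ s * ev (x s) (zipWith _+_ (digits a n) y)
        at n s y≈ = ≈-trans (≈-reflexive (lem₁ (δ s) (δ′ s) (γ s) E))
          (≈-trans (≈-+ (≈-refl {δ′ s + γ s * E}) (≈-*ˡ (δ s - δ′ s) (≈-sym (proj₂ (unit s)))))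
          (≈-trans (≈-reflexive (lem₂ (δ s) (δ′ s) (γ s) E h))
          (≈-trans (≈-+ (≈-refl {δ′ s + γ s * E}) (≈-*ˡ (γ s) (≈-sym y≈)))
          (≈-reflexive (trans (lem₃ (δ′ s) (γ s) E (ev (x s) y))
            (cong (λ z → δ′ s + γ s * z) (sym (ev-+ (x s) (digits a n) y))))))))
          where h = proj₁ (unit s)
                E = ev (x s) (digits a n)

    Extensional : (Word → ℕ) → Set
    Extensional H = ∀ u v → (∀ t → u t ≡ v t) → H u ≡ H v

    -- Both sides, times the number of codewords, compute the double sum of H over γ p + γ′ q.
    codeSum-uniform : ∀ H → Extensional H → Invariant H →
      ∀ γ → Units γ → ∀ γ′ → Units γ′ → ∀ δ δ′ → codeSum γ δ H ≡ codeSum γ′ δ′ H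
    codeSum-uniform H ext inv γ unit γ′ unit′ δ δ′ = ℕ.*-cancelˡ-≡ _ _ (μ ^ a) {{ℕ.m^n≢0 μ a}} (begin
      μ ^ a ℕ.* codeSum γ δ H
        ≡⟨ sym (Σ<-const (μ ^ a) _) ⟩
      Σ< (μ ^ a) (λ m → codeSum γ δ H)
        ≡⟨ Σ<-ext (μ ^ a) (λ m → translate inv γ unit δ (part γ′ m)) ⟩
      Σ< (μ ^ a) (λ m → Σ< (μ ^ a) (λ n → H (codeword γ (part γ′ m) n)))
        ≡⟨ Σ<-swap (μ ^ a) (μ ^ a) _ ⟩
      Σ< (μ ^ a) (λ n → Σ< (μ ^ a) (λ m → H (codeword γ (part γ′ m) n)))
        ≡⟨ Σ<-ext (μ ^ a) (λ n → Σ<-ext (μ ^ a) λ m → ext _ _ λ t → ℤ.+-comm (part γ′ m t) (part γ n t)) ⟩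
      Σ< (μ ^ a) (λ n → codeSum γ′ (part γ n) H)
        ≡⟨ Σ<-ext (μ ^ a) (λ n → translate inv γ′ unit′ (part γ n) δ′) ⟩
      Σ< (μ ^ a) (λ n → codeSum γ′ δ′ H)
        ≡⟨ Σ<-const (μ ^ a) _ ⟩
      μ ^ a ℕ.* codeSum γ′ δ′ H ∎)
      where
      open ≡-Reasoning
      part : Word → ℕ → Word
      part γ n t = γ t * ev (x t) (digits a n)

    invariant-ext : ∀ {H H′} → (∀ u → H u ≡ H′ u) → Invariant H → Invariant H′
    invariant-ext eq inv = invariant λ γ unit δ δ′ → trans (sym (Σ<-ext (μ ^ a) (λ n → eq _)))
      (trans (translate inv γ unit δ δ′) (Σ<-ext (μ ^ a) (λ n → eq _)))

    invariant-+ : ∀ {H H′} → Invariant H → Invariant H′ → Invariant (λ u → H u ℕ.+ H′ u)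
    invariant-+ {H} {H′} inv inv′ = invariant λ γ unit δ δ′ → trans (Σ<-+ (μ ^ a) (λ n → H (codeword γ δ n)) _)
      (trans (cong₂ ℕ._+_ (translate inv γ unit δ δ′) (translate inv′ γ unit δ δ′))
             (sym (Σ<-+ (μ ^ a) (λ n → H (codeword γ δ′ n)) _)))

    encode : ∀ m → (Fin m → ℕ) → ℕ
    encode zero    f = 0
    encode (suc m) f = f zero ℕ.+ μ ℕ.* encode m (f ∘ suc)

    module Powers (c₀ κ : ℕ) where

      -- Coordinate `zero` is left out: its digit selects the scaling factor and must be movable
      -- while `base` stays fixed.
      base : Word → ℕ
      base u = c₀ ℕ.+ κ ℕ.* encode T (λ t → dg (u (suc t)))

      -- Expanding the power, every monomial involves few coordinates.
      power-invariant : ∀ n S K → n ℕ.+ length S ≤ a → DependsOn S K → Invariant (λ u → K u ℕ.* base u ^ n)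
      power-invariant zero    S K le dep = dependsOn⇒invariant S _ le (λ u v u≈v → cong (ℕ._* 1) (dep u v u≈v))
      power-invariant (suc n) S K le dep = invariant-ext
        (λ u → lem (K u) c₀ (κ ℕ.* encode T (λ t → dg (u (suc t)))) (base u ^ n))
        (invariant-+ (power-invariant n S (λ u → c₀ ℕ.* K u) (ℕ.<⇒≤ le) (λ u v u≈v → cong (c₀ ℕ.*_) (dep u v u≈v)))
                     (terms T suc κ))
        where
        lem : ∀ K c L B → c ℕ.* K ℕ.* B ℕ.+ K ℕ.* L ℕ.* B ≡ K ℕ.* ((c ℕ.+ L) ℕ.* B)
        lem = ℕSolver.solve-∀
        lem₀ : ∀ K k B → 0 ≡ K ℕ.* (k ℕ.* 0) ℕ.* B
        lem₀ = ℕSolver.solve-∀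
        lem₁ : ∀ K k f m L B → K ℕ.* (k ℕ.* f) ℕ.* B ℕ.+ K ℕ.* (k ℕ.* m ℕ.* L) ℕ.* B ≡ K ℕ.* (k ℕ.* (f ℕ.+ m ℕ.* L)) ℕ.* B
        lem₁ = ℕSolver.solve-∀
        -- The encoded number is expanded digit by digit, `k` collecting the powers of `μ`. Each
        -- digit adds one coordinate to `S` and uses up one factor `base`, so `n + length S` does
        -- not grow.
        terms : ∀ m (ι : Fin m → Fin (suc T)) k →
          Invariant (λ u → K u ℕ.* (k ℕ.* encode m (λ t → dg (u (ι t)))) ℕ.* base u ^ n)
        terms zero    ι k = invariant-ext (λ u → lem₀ (K u) k (base u ^ n))
          (dependsOn⇒invariant [] (λ _ → 0) z≤n (λ _ _ _ → refl))
        terms (suc m) ι k = invariant-ext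
          (λ u → lem₁ (K u) k (dg (u (ι zero))) μ (encode m (λ t → dg (u (ι (suc t))))) (base u ^ n))
          (invariant-+
            (power-invariant n (ι zero ∷ S) (λ u → K u ℕ.* (k ℕ.* dg (u (ι zero))))
              (subst (_≤ a) (sym (ℕ.+-suc n (length S))) le)
              (λ { u v (i≈ ∷ u≈v) → cong₂ ℕ._*_ (dep u v u≈v) (cong (k ℕ.*_) (dg-cong i≈)) }))
            (terms m (ι ∘ suc) (k ℕ.* μ)))

      encode-cong : ∀ m {f g : Fin m → ℕ} → (∀ t → f t ≡ g t) → encode m f ≡ encode m g
      encode-cong zero    eq = refl
      encode-cong (suc m) eq = cong₂ (λ p q → p ℕ.+ μ ℕ.* q) (eq zero) (encode-cong m (eq ∘ suc))

      base-cong : ∀ {u v : Word} → (∀ t → u (suc t) ≡ v (suc t)) → base u ≡ base v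
      base-cong eq = cong (λ y → c₀ ℕ.+ κ ℕ.* y) (encode-cong T (λ t → cong dg (eq t)))

      scaled : (ℕ → ℕ) → ℕ → Word → ℕ
      scaled k n u = k (dg (u zero)) ℕ.* base u ^ n

      scaled-extensional : ∀ k n → Extensional (scaled k n)
      scaled-extensional k n u v eq =
        cong₂ (λ p q → k p ℕ.* q ^ n) (cong dg (eq zero)) (base-cong {u} {v} (eq ∘ suc))

      -- The selecting digit occupies one of the `a` available coordinates, the power at most `n`
      -- others.
      scaled-invariant : ∀ k n → n < a → Invariant (scaled k n)
      scaled-invariant k n n<a = power-invariant n (zero ∷ []) (λ u → k (dg (u zero)))
        (subst (_≤ a) (ℕ.+-comm 1 n) n<a) (λ { u v (z≈ ∷ []) → cong k (dg-cong z≈) })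

      -- The digit at the point x zero is uniform and independent of the factor base u ^ n.
      codeSum-scaled : ∀ k n → n < a → ∀ γ → Units γ → ∀ δ →
        μ ℕ.* codeSum γ δ (scaled k n) ≡ Σ< μ k ℕ.* codeSum γ δ (λ u → base u ^ n)
      codeSum-scaled k n n<a γ unit δ = begin
        μ ℕ.* codeSum γ δ (scaled k n)
          ≡⟨ sym (Σ<-const μ _) ⟩
        Σ< μ (λ s → codeSum γ δ (scaled k n))
          ≡⟨ Σ<-ext μ (λ s → translate (scaled-invariant k n n<a) γ unit δ (moved s)) ⟩
        Σ< μ (λ s → codeSum γ (moved s) (scaled k n))
          ≡⟨ Σ<-swap μ (μ ^ a) (λ s m → scaled k n (codeword γ (moved s) m)) ⟩
        Σ< (μ ^ a) (λ m → Σ< μ (λ s → scaled k n (codeword γ (moved s) m)))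
          ≡⟨ Σ<-ext (μ ^ a) (λ m → trans (Σ<-*ʳ μ (base (codeword γ δ m) ^ n) (λ s → k (dg (codeword γ (moved s) m zero)))) (cong (ℕ._* base (codeword γ δ m) ^ n) (uniform m))) ⟩
        Σ< (μ ^ a) (λ m → Σ< μ k ℕ.* base (codeword γ δ m) ^ n)
          ≡⟨ Σ<-*ˡ (μ ^ a) (Σ< μ k) _ ⟩
        Σ< μ k ℕ.* codeSum γ δ (λ u → base u ^ n) ∎
        where
        open ≡-Reasoning
        -- Translating only coordinate `zero` lets the selecting digit run through all residues for
        -- each fixed value of `base`.
        moved : ℕ → Word
        moved s zero    = + s + δ zero
        moved s (suc t) = δ (suc t)
        uniform : ∀ m → Σ< μ (λ s → k (dg (codeword γ (moved s) m zero))) ≡ Σ< μ k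
        uniform m = begin
          Σ< μ (λ s → k (dg (+ s + δ zero + γ zero * ev (x zero) (digits a m))))
            ≡⟨ Σ<-ext μ (λ s → cong (k ∘ dg) (ℤ.+-assoc (+ s) (δ zero) (γ zero * ev (x zero) (digits a m)))) ⟩
          Σ< μ (λ s → k (dg (+ s + codeword γ δ m zero)))
            ≡⟨ Σ<-shift (k ∘ dg) (λ a≈b → cong k (dg-cong a≈b)) (codeword γ δ m zero) ⟩
          Σ< μ (λ s → k (dg (+ s)))
            ≡⟨ Σ<-cong μ (λ s s<μ → cong k (dg-small s<μ)) ⟩
          Σ< μ k ∎

  ev-++ : ∀ {a b} n (v : Vec ℤ a) (w : Vec ℤ b) → ev (+ n) (v ++ w) ≡ ev (+ n) v + + (n ^ a) * ev (+ n) w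
  ev-++ n [] w = lem (ev (+ n) w)
    where lem : ∀ p → p ≡ 0ℤ + 1ℤ * p
          lem = solve-∀
  ev-++ {suc a} n (c ∷ v) w = trans (cong (λ y → c + + n * y) (ev-++ n v w))
    (trans (lem c (+ n) (ev (+ n) v) (+ (n ^ a)) (ev (+ n) w))
           (cong (λ y → c + + n * ev (+ n) v + y * ev (+ n) w) (sym (ℤ.pos-* n (n ^ a)))))
    where lem : ∀ c x p y q → c + x * (p + y * q) ≡ c + x * p + x * y * q
          lem = solve-∀

  ev-diff : ∀ {a} x (v w : Vec ℤ a) → ev x (zipWith _-_ v w) ≡ ev x v - ev x w
  ev-diff x []      []      = refl
  ev-diff x (c ∷ v) (d ∷ w) rewrite ev-diff x v w = lem c d x (ev x v) (ev x w)
    where lem : ∀ c d x p q → c - d + x * (p - q) ≡ c + x * p - (d + x * q)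
          lem = solve-∀

  module DigitVectors (X : ℕ) where

    open Residues X

    Digit : ℤ → Set
    Digit z = Σ ℕ λ m → m < μ × z ≡ + m

    digits-digit : ∀ a n → VAll Digit (digits a n)
    digits-digit zero    n = []
    digits-digit (suc a) n = (n ℕ.% μ , ℕ.m%n<n n μ , refl) ∷ digits-digit a (n ℕ./ μ)

    digits-injective : ∀ a {m n} → m < μ ^ a → n < μ ^ a → digits a m ≡ digits a n → m ≡ n
    digits-injective zero    m<1 n<1 _  = trans (ℕ.n<1⇒n≡0 m<1) (sym (ℕ.n<1⇒n≡0 n<1))
    digits-injective (suc a) {m} {n} m< n< eq = begin
      m                             ≡⟨ ℕ.m≡m%n+[m/n]*n m μ ⟩
      m ℕ.% μ ℕ.+ m ℕ./ μ ℕ.* μ     ≡⟨ cong₂ (λ p q → p ℕ.+ q ℕ.* μ) (ℤ.+-injective (Vec.∷-injectiveˡ eq))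
                                         (digits-injective a (quot m<) (quot n<) (Vec.∷-injectiveʳ eq)) ⟩
      n ℕ.% μ ℕ.+ n ℕ./ μ ℕ.* μ     ≡⟨ sym (ℕ.m≡m%n+[m/n]*n n μ) ⟩
      n                             ∎
      where
      open ≡-Reasoning
      quot : ∀ {k} → k < μ ^ suc a → k ℕ./ μ < μ ^ a
      quot {k} k< = ℕ.m<n*o⇒m/o<n (subst (k <_) (ℕ.*-comm μ (μ ^ a)) k<)

    null-diff : ∀ {a} {v w : Vec ℤ a} → VAll Digit v → VAll Digit w → NullV (zipWith _-_ v w) → v ≡ w
    null-diff [] [] [] = refl
    null-diff ((m , m<μ , refl) ∷ ds) ((n , n<μ , refl) ∷ es) (z ∷ zs) =
      cong₂ _∷_ (cong +_ (residue-unique m<μ n<μ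
        (≈-trans (≈-reflexive (lem (+ m) (+ n))) (≈-trans (≈-+ z (≈-refl {+ n})) (≈-reflexive (ℤ.+-identityˡ (+ n)))))))
        (null-diff ds es zs)
      where lem : ∀ m n → m ≡ m - n + n
            lem = solve-∀

    -- The addition m + n = μ^a - 1 has no carries.
    ev-complement : ∀ a x {m n} → suc (m ℕ.+ n) ≡ μ ^ a →
      ev x (digits a m) + ev x (digits a n) ≡ ev x (replicate a (+ X))
    ev-complement zero    x eq = refl
    ev-complement (suc a) x {m} {n} eq = begin
      + p + x * ev x (digits a m′) + (+ q + x * ev x (digits a n′))
        ≡⟨ lem (+ p) (+ q) x (ev x (digits a m′)) (ev x (digits a n′)) ⟩
      + p + + q + x * (ev x (digits a m′) + ev x (digits a n′))
        ≡⟨ cong₂ (λ y z → y + x * z) (cong +_ p+q≡X) (ev-complement a x rest) ⟩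
      + X + x * ev x (replicate a (+ X)) ∎
      where
      open ≡-Reasoning
      lem : ∀ p q x y z → p + x * y + (q + x * z) ≡ p + q + x * (y + z)
      lem = solve-∀
      p = m ℕ.% μ
      q = n ℕ.% μ
      m′ = m ℕ./ μ
      n′ = n ℕ./ μ
      lem₂ : ∀ p q m n μ → suc (p ℕ.+ q) ℕ.+ (m ℕ.+ n) ℕ.* μ ≡ suc (p ℕ.+ m ℕ.* μ ℕ.+ (q ℕ.+ n ℕ.* μ))
      lem₂ = ℕSolver.solve-∀
      total : suc (p ℕ.+ q) ℕ.+ (m′ ℕ.+ n′) ℕ.* μ ≡ μ ^ a ℕ.* μ
      total = trans (lem₂ p q m′ n′ μ) (trans (cong₂ (λ y z → suc (y ℕ.+ z))
        (sym (ℕ.m≡m%n+[m/n]*n m μ)) (sym (ℕ.m≡m%n+[m/n]*n n μ))) (trans eq (ℕ.*-comm μ (μ ^ a))))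
      p≤X = ℕ.≤-pred (ℕ.m%n<n m μ)
      q≤X = ℕ.≤-pred (ℕ.m%n<n n μ)
      multiple : suc (p ℕ.+ q) ℕ.% μ ≡ 0
      multiple = trans (sym (ℕ.[m+kn]%n≡m%n (suc (p ℕ.+ q)) (m′ ℕ.+ n′) μ))
        (trans (cong (ℕ._% μ) total) (ℕ.m*n%n≡0 (μ ^ a) μ))
      -- `p + q + 1` is a multiple of `μ` between 1 and `2 * μ - 1`, hence equal to `μ`.
      p+q≡X : p ℕ.+ q ≡ X
      p+q≡X with ℕ.<-cmp (p ℕ.+ q) X
      ... | tri≈ _ eq′ _ = eq′
      ... | tri< lt _ _ = ⊥-elim (ℕ.1+n≢0 (trans (sym (ℕ.m<n⇒m%n≡m (s≤s lt))) multiple))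
      ... | tri> _ _ gt = ⊥-elim (ℕ.1+n≢0 {(p ℕ.+ q) ∸ suc X} (trans (sym over) multiple))
        where
        k = (p ℕ.+ q) ∸ suc X
        k≡ : suc k ℕ.+ 1 ℕ.* μ ≡ suc (p ℕ.+ q)
        k≡ = trans (cong (suc k ℕ.+_) (ℕ.*-identityˡ μ)) (cong suc (ℕ.m∸n+n≡m gt))
        k< : suc k < μ
        k< = ℕ.+-cancelʳ-< (1 ℕ.* μ) (suc k) μ (subst₂ _<_ (sym k≡) (cong (μ ℕ.+_) (sym (ℕ.*-identityˡ μ)))
               (s≤s (ℕ.≤-trans (s≤s (ℕ.+-mono-≤ p≤X q≤X)) (ℕ.≤-reflexive (sym (ℕ.+-suc X X))))))
        over : suc (p ℕ.+ q) ℕ.% μ ≡ suc k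
        over = trans (cong (ℕ._% μ) (sym k≡)) (trans (ℕ.[m+kn]%n≡m%n (suc k) 1 μ) (ℕ.m<n⇒m%n≡m k<))
      rest : suc (m′ ℕ.+ n′) ≡ μ ^ a
      rest = ℕ.*-cancelʳ-≡ _ _ μ (trans (cong (λ y → suc y ℕ.+ (m′ ℕ.+ n′) ℕ.* μ) (sym p+q≡X)) total)

  -- The number of coefficients of `poly`: `a` digits for each of `u` and `v`, `c` for each of `r`
  -- and `s`. Values at that many points determine it; one further point serves as selector.
  numPoints : ℕ → ℕ → ℕ
  numPoints a c = a ℕ.+ (a ℕ.+ (c ℕ.+ c))

  -- For points `x` this bounds `x ^ a` and `1 + x ^ a` as well as all differences of points, which
  -- have to be units.
  unitBound : ℕ → ℕ → ℕ
  unitBound a c = suc ((2 ℕ.+ numPoints a c) ^ a)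

  -- Blocks over a single modulus.

  module World (d c e tag X : ℕ)
    (invertible : ∀ u → 0 < u → u ≤ unitBound (suc d) c → u ∣ X) where

    open Residues X
    open DigitVectors X

    a T : ℕ
    a = suc d
    T = numPoints a c

    -- The points start at 2 because 1 - x^a has to be invertible as well.
    point : Fin (suc T) → ℕ
    point t = 2 ℕ.+ toℕ t

    x : Fin (suc T) → ℤ
    x t = + point t

    -- From `X = q * u` follows `u * (- q) = - X`, which is 1 modulo `μ = X + 1`.
    unit-pos : ∀ u → 0 < u → u ≤ unitBound a c → Unit (+ u)
    unit-pos u 0<u u≤ with invertible u 0<u u≤
    ... | divides q X≡ = - + q , by (- 1ℤ) (trans (lem (+ u) (+ q))
            (cong (λ y → 1ℤ + - 1ℤ * (1ℤ + y)) (trans (sym (ℤ.pos-* q u)) (cong +_ (sym X≡)))))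
      where lem : ∀ u q → u * - q ≡ 1ℤ + - 1ℤ * (1ℤ + q * u)
            lem = solve-∀

    unit-neg : ∀ z → Unit z → Unit (- z)
    unit-neg z (h , zh) = - h , ≈-trans (≈-reflexive (lem z h)) zh
      where lem : ∀ z h → - z * - h ≡ z * h
            lem = solve-∀

    point≤ : ∀ t → point t ≤ 2 ℕ.+ T
    point≤ t = s≤s (s≤s (ℕ.≤-pred (Fin.toℕ<n t)))

    point-pow≤ : ∀ t → point t ^ a ≤ (2 ℕ.+ T) ^ a
    point-pow≤ t = ℕ.^-monoˡ-≤ a (point≤ t)

    point-pow> : ∀ t → 1 < point t ^ a
    point-pow> t = ℕ.*-mono-≤ {2} {point t} {1} (s≤s (s≤s z≤n)) (ℕ.m^n>0 (point t) d)

    unit-gap : ∀ m n → m < n → n ≤ 2 ℕ.+ T → Unit (+ n - + m)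
    unit-gap m n m<n n≤ = subst Unit (trans (sym (ℤ.⊖-≥ (ℕ.<⇒≤ m<n))) (sym (ℤ.m-n≡m⊖n n m)))
      (unit-pos (n ∸ m) (ℕ.m<n⇒0<n∸m m<n)
        (ℕ.≤-trans (ℕ.m∸n≤m n m) (ℕ.≤-trans n≤ (ℕ.≤-trans (ℕ.m≤m*n (2 ℕ.+ T) ((2 ℕ.+ T) ^ d) {{ℕ.m^n≢0 (2 ℕ.+ T) d}}) (ℕ.n≤1+n _)))))

    diff : ∀ s t → s ≢ t → Unit (x s - x t)
    diff s t s≢t with ℕ.<-cmp (point s) (point t)
    ... | tri≈ _ eq _ = ⊥-elim (s≢t (Fin.toℕ-injective (ℕ.suc-injective (ℕ.suc-injective eq))))
    ... | tri> _ _ gt = unit-gap (point t) (point s) gt (point≤ s)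
    ... | tri< lt _ _ = subst Unit (lem (x s) (x t)) (unit-neg (x t - x s) (unit-gap (point s) (point t) lt (point≤ t)))
      where lem : ∀ s t → - (t - s) ≡ s - t
            lem = solve-∀

    open Code X T a x diff
    -- These bases are odd, so that a factor 2^g splits off uniquely; they are 1 modulo e; and modulo
    -- 6e they reveal the tag, which tells the three moduli apart.
    open Powers (1 ℕ.+ 2 ℕ.* (e ℕ.* tag)) (6 ℕ.* e) public

    -- The multipliers that belong to a moving `u` (columns), a moving `v` (rows), the diagonal and
    -- the antidiagonal.
    one pow plus minus : Word
    one   t = 1ℤ
    pow   t = + (point t ^ a)
    plus  t = 1ℤ + pow t
    minus t = 1ℤ - pow t

    units-one : Units one
    units-one t = 1ℤ , ≈-refl

    units-pow : Units pow
    units-pow t = unit-pos _ (ℕ.<⇒≤ (point-pow> t)) (ℕ.m≤n⇒m≤1+n (point-pow≤ t))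

    units-plus : Units plus
    units-plus t = unit-pos _ z<s (s≤s (point-pow≤ t))

    units-minus : Units minus
    units-minus t = subst Unit (trans (cong -_ (sym (trans (ℤ.m-n≡m⊖n (point t ^ a) 1) (ℤ.⊖-≥ (ℕ.<⇒≤ (point-pow> t))))))
        (lem (pow t))) (unit-neg (+ (point t ^ a ∸ 1)) (unit-pos (point t ^ a ∸ 1) (ℕ.m<n⇒0<n∸m (point-pow> t))
        (ℕ.≤-trans (ℕ.m∸n≤m _ 1) (ℕ.m≤n⇒m≤1+n (point-pow≤ t)))))
      where lem : ∀ p → - (p - 1ℤ) ≡ 1ℤ - p
            lem = solve-∀

    -- At `x` its value is `u(x) + x^a v(x)` plus `x^(2a)` times a part fixed by the label, so lines
    -- of a block become cosets of the code.
    poly : (r s u v : ℕ) → Vec ℤ T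
    poly r s u v = digits a u ++ (digits a v ++ (digits c r ++ digits c s))

    word : (r s u v : ℕ) → Word
    word r s u v t = ev (x t) (poly r s u v)

    word-split : ∀ r s u v t → word r s u v t ≡
      ev (x t) (digits a u) + pow t * (ev (x t) (digits a v) + pow t * ev (x t) (digits c r ++ digits c s))
    word-split r s u v t = trans (ev-++ (point t) (digits a u) _)
      (cong (λ y → ev (x t) (digits a u) + pow t * y) (ev-++ (point t) (digits a v) _))

    block : (ℕ → ℕ) → (r s u v : ℕ) → ℕ
    block ℓ r s u v = ℓ (dg (word r s u v zero)) ℕ.* base (word r s u v)

    module Sums (ℓ : ℕ → ℕ) where

      H : Word → ℕ
      H = scaled (λ k → ℓ k ^ d) d

      origin : Word
      origin t = 0ℤ

      magicSum : ℕ
      magicSum = codeSum one origin H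

      -- Once a line is recognized as a coset, `codeSum-uniform` makes its sum independent of the
      -- multipliers, the line and the label.
      line-sum : ∀ γ → Units γ → ∀ δ r s (f g : ℕ → ℕ) →
        (∀ n → n < μ ^ a → ∀ t → word r s (f n) (g n) t ≡ codeword γ δ n t) →
        Σ< (μ ^ a) (λ n → block ℓ r s (f n) (g n) ^ d) ≡ magicSum
      line-sum γ unit δ r s f g eq = trans
        (Σ<-cong (μ ^ a) λ n n< → trans (^-distribʳ-* d (ℓ (dg (word r s (f n) (g n) zero))) _)
          (scaled-extensional (λ k → ℓ k ^ d) d _ _ (eq n n<)))
        (codeSum-uniform H (scaled-extensional (λ k → ℓ k ^ d) d) (scaled-invariant (λ k → ℓ k ^ d) d ℕ.≤-refl) γ unit one units-one δ origin)

      block-row : ∀ r s u → Σ< (μ ^ a) (λ v → block ℓ r s u v ^ d) ≡ magicSum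
      block-row r s u = line-sum pow units-pow
        (λ t → ev (x t) (digits a u) + pow t * (pow t * ev (x t) (digits c r ++ digits c s))) r s (λ _ → u) (λ v → v)
        (λ v _ t → trans (word-split r s u v t) (lem (ev (x t) (digits a u)) (pow t) (ev (x t) (digits a v)) _))
        where lem : ∀ u p v k → u + p * (v + p * k) ≡ u + p * (p * k) + p * v
              lem = solve-∀

      block-col : ∀ r s v → Σ< (μ ^ a) (λ u → block ℓ r s u v ^ d) ≡ magicSum
      block-col r s v = line-sum one units-one
        (λ t → pow t * (ev (x t) (digits a v) + pow t * ev (x t) (digits c r ++ digits c s))) r s (λ u → u) (λ _ → v)
        (λ u _ t → trans (word-split r s u v t) (lem (ev (x t) (digits a u)) _))
        where lem : ∀ u k → u + k ≡ k + 1ℤ * u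
              lem = solve-∀

      block-diag : ∀ r s → Σ< (μ ^ a) (λ u → block ℓ r s u u ^ d) ≡ magicSum
      block-diag r s = line-sum plus units-plus
        (λ t → pow t * (pow t * ev (x t) (digits c r ++ digits c s))) r s (λ u → u) (λ u → u)
        (λ u _ t → trans (word-split r s u u t) (lem (ev (x t) (digits a u)) (pow t) _))
        where lem : ∀ u p k → u + p * (u + p * k) ≡ p * (p * k) + (1ℤ + p) * u
              lem = solve-∀

      -- The digits of `v` complement those of `u`, so `v(x)` is a fixed polynomial minus `u(x)`;
      -- this leaves the multiplier `1 - x^a`.
      block-anti : ∀ r s → Σ< (μ ^ a) (λ u → block ℓ r s u (μ ^ a ∸ suc u) ^ d) ≡ magicSum
      block-anti r s = line-sum minus units-minus
        (λ t → pow t * (ev (x t) (replicate a (+ X)) + pow t * ev (x t) (digits c r ++ digits c s))) r s (λ u → u) (λ u → μ ^ a ∸ suc u)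
        (λ u u< t → trans (word-split r s u (μ ^ a ∸ suc u) t) (trans
          (lem (ev (x t) (digits a u)) (ev (x t) (digits a (μ ^ a ∸ suc u))) (pow t) _)
          (cong (λ y → pow t * (y + pow t * ev (x t) (digits c r ++ digits c s)) + minus t * ev (x t) (digits a u))
            (ev-complement a (x t) {u} {μ ^ a ∸ suc u} (ℕ.m+[n∸m]≡n u<)))))
        where lem : ∀ u v p k → u + p * (v + p * k) ≡ p * (u + v + p * k) + (1ℤ - p) * u
              lem = solve-∀

    power-sum : ℕ
    power-sum = codeSum one (λ _ → 0ℤ) (λ u → base u ^ d)

    magicSum-scaled : ∀ ℓ → μ ℕ.* Sums.magicSum ℓ ≡ Σ< μ (λ k → ℓ k ^ d) ℕ.* power-sum
    magicSum-scaled ℓ = codeSum-scaled (λ k → ℓ k ^ d) d ℕ.≤-refl one units-one (λ _ → 0ℤ)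

    number : Word → ℕ
    number w = encode T (λ t → dg (w (suc t)))

    base-form : ∀ w → base w ≡ 1 ℕ.+ 2 ℕ.* (e ℕ.* (tag ℕ.+ 3 ℕ.* number w))
    base-form w = lem e tag (number w)
      where lem : ∀ e t n → 1 ℕ.+ 2 ℕ.* (e ℕ.* t) ℕ.+ 6 ℕ.* e ℕ.* n ≡ 1 ℕ.+ 2 ℕ.* (e ℕ.* (t ℕ.+ 3 ℕ.* n))
            lem = ℕSolver.solve-∀

    encode< : ∀ m (f : Fin m → ℕ) → (∀ t → f t < μ) → encode m f < μ ^ m
    encode< zero    f f< = z<s
    encode< (suc m) f f< = ℕ.≤-trans (s≤s (ℕ.+-monoˡ-≤ _ (ℕ.≤-pred (f< zero))))
      (ℕ.≤-trans (ℕ.≤-reflexive (sym (ℕ.*-suc μ _))) (ℕ.*-monoʳ-≤ μ (encode< m (f ∘ suc) (f< ∘ suc))))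

    encode-injective : ∀ m (f g : Fin m → ℕ) → (∀ t → f t < μ) → (∀ t → g t < μ) →
      encode m f ≡ encode m g → ∀ t → f t ≡ g t
    encode-injective (suc m) f g f< g< eq = λ { zero → head≡ ; (suc t) → tail≡ t }
      where
      low : ∀ (h : Fin (suc m) → ℕ) → (∀ t → h t < μ) → encode (suc m) h ℕ.% μ ≡ h zero
      low h h< = trans (cong (λ y → (h zero ℕ.+ y) ℕ.% μ) (ℕ.*-comm μ _))
        (trans (ℕ.[m+kn]%n≡m%n (h zero) (encode m (h ∘ suc)) μ) (ℕ.m<n⇒m%n≡m (h< zero)))
      head≡ : f zero ≡ g zero
      head≡ = trans (sym (low f f<)) (trans (cong (ℕ._% μ) eq) (low g g<))
      tail≡ : ∀ t → f (suc t) ≡ g (suc t)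
      tail≡ = encode-injective m (f ∘ suc) (g ∘ suc) (f< ∘ suc) (g< ∘ suc)
        (ℕ.*-cancelˡ-≡ _ _ μ (ℕ.+-cancelˡ-≡ (f zero) _ _ (trans eq (cong (ℕ._+ _) (sym head≡)))))

    -- `number` encodes the values at `T` points, which determine a polynomial with `T`
    -- coefficients; its coefficients are genuine digits and not just residues.
    number-injective : ∀ {r s u v r′ s′ u′ v′} → r < μ ^ c → s < μ ^ c → u < μ ^ a → v < μ ^ a →
      r′ < μ ^ c → s′ < μ ^ c → u′ < μ ^ a → v′ < μ ^ a →
      number (word r s u v) ≡ number (word r′ s′ u′ v′) → (r ≡ r′ × s ≡ s′) × (u ≡ u′ × v ≡ v′)
    number-injective {r} {s} {u} {v} {r′} {s′} {u′} {v′} r< s< u< v< r′< s′< u′< v′< eq =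
      (digits-injective c r< r′< (Vec.++-injectiveˡ (digits c r) (digits c r′) tl) ,
       digits-injective c s< s′< (Vec.++-injectiveʳ (digits c r) (digits c r′) tl)) ,
      (digits-injective a u< u′< (Vec.++-injectiveˡ (digits a u) (digits a u′) polys) ,
       digits-injective a v< v′< (Vec.++-injectiveˡ (digits a v) (digits a v′) rest))
      where
      p = poly r s u v
      p′ = poly r′ s′ u′ v′
      all-digits : ∀ r s u v → VAll Digit (poly r s u v)
      all-digits r s u v = VAll.++⁺ (digits-digit a u) (VAll.++⁺ (digits-digit a v)
        (VAll.++⁺ (digits-digit c r) (digits-digit c s)))
      root : ∀ t → ev (x (suc t)) (zipWith _-_ p p′) ≈ 0ℤ
      root t = ≈-trans (≈-reflexive (ev-diff (x (suc t)) p p′))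
        (≈-trans (≈-+ (dg-injective {word r s u v (suc t)} {word r′ s′ u′ v′ (suc t)} (encode-injective T (λ t → dg (word r s u v (suc t))) (λ t → dg (word r′ s′ u′ v′ (suc t)))
          (λ t → dg< (word r s u v (suc t))) (λ t → dg< (word r′ s′ u′ v′ (suc t))) eq t)) (≈-refl { - ev (x (suc t)) p′}))
                 (≈-reflexive (ℤ.+-inverseʳ (ev (x (suc t)) p′))))
      polys : p ≡ p′
      polys = null-diff (all-digits r s u v) (all-digits r′ s′ u′ v′)
        (roots-null T (x ∘ suc) (λ s t s≢t → diff (suc s) (suc t) (s≢t ∘ Fin.suc-injective)) (zipWith _-_ p p′) root)
      rest = Vec.++-injectiveʳ (digits a u) (digits a u′) polys
      tl = Vec.++-injectiveʳ (digits a v) (digits a v′) rest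

    base≤ : 0 < e → tag ≤ 2 → 6 ℕ.* e ≤ μ → ∀ w → base w ≤ μ ^ suc T
    base≤ 0<e tag≤2 6e≤μ w = begin
      1 ℕ.+ 2 ℕ.* (e ℕ.* tag) ℕ.+ 6 ℕ.* e ℕ.* number w
        ≤⟨ ℕ.+-monoˡ-≤ _ (ℕ.+-mono-≤ 0<e (ℕ.*-monoʳ-≤ 2 (ℕ.*-monoʳ-≤ e tag≤2))) ⟩
      e ℕ.+ 2 ℕ.* (e ℕ.* 2) ℕ.+ 6 ℕ.* e ℕ.* number w
        ≤⟨ ℕ.m≤m+n _ e ⟩
      e ℕ.+ 2 ℕ.* (e ℕ.* 2) ℕ.+ 6 ℕ.* e ℕ.* number w ℕ.+ e
        ≡⟨ lem e (number w) ⟩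
      6 ℕ.* e ℕ.* suc (number w)
        ≤⟨ ℕ.*-mono-≤ 6e≤μ (encode< T (λ t → dg (w (suc t))) (λ t → dg< (w (suc t)))) ⟩
      μ ^ suc T ∎
      where
      open ℕ.≤-Reasoning
      lem : ∀ e n → e ℕ.+ 2 ℕ.* (e ℕ.* 2) ℕ.+ 6 ℕ.* e ℕ.* n ℕ.+ e ≡ 6 ℕ.* e ℕ.* suc n
      lem = ℕSolver.solve-∀

    power-sum≤ : 0 < e → tag ≤ 2 → 6 ℕ.* e ≤ μ → power-sum ≤ μ ^ (a ℕ.+ suc T ℕ.* d)
    power-sum≤ 0<e tag≤2 6e≤μ = ℕ.≤-trans
      (Σ<-≤ (μ ^ a) _ (μ ^ (suc T ℕ.* d)) λ n → ℕ.≤-trans (ℕ.^-monoˡ-≤ d (base≤ 0<e tag≤2 6e≤μ (codeword one (λ _ → 0ℤ) n)))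
        (ℕ.≤-reflexive (ℕ.^-*-assoc μ (suc T) d)))
      (ℕ.≤-reflexive (sym (ℕ.^-distribˡ-+-* μ a (suc T ℕ.* d))))

    power-sum>0 : 0 < power-sum
    power-sum>0 = ℕ.≤-trans (ℕ.m^n>0 μ a) (ℕ.≤-trans (ℕ.≤-reflexive (sym (ℕ.*-identityʳ (μ ^ a))))
      (Σ<-≥ (μ ^ a) _ 1 λ n → ℕ.m^n>0 (base (codeword one (λ _ → 0ℤ) n)) d))

    -- Every summand is 1 modulo `e`, and so is the number `μ ^ a` of summands.
    power-sum-One : e ∣ X → One e power-sum
    power-sum-One (divides q X≡) = proj₁ W-One ℕ.+ proj₁ total , trans (proj₂ total)
      (trans (cong (ℕ._+ e ℕ.* proj₁ total) (proj₂ W-One)) (lem₂ e (proj₁ W-One) (proj₁ total)))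
      where
      lem : ∀ e y → 1 ℕ.+ 2 ℕ.* (e ℕ.* y) ≡ 1 ℕ.+ e ℕ.* (2 ℕ.* y)
      lem = ℕSolver.solve-∀
      lem₂ : ∀ e p q → 1 ℕ.+ e ℕ.* p ℕ.+ e ℕ.* q ≡ 1 ℕ.+ e ℕ.* (p ℕ.+ q)
      lem₂ = ℕSolver.solve-∀
      base-One : ∀ w → One e (base w)
      base-One w = 2 ℕ.* (tag ℕ.+ 3 ℕ.* number w) , trans (base-form w) (lem e (tag ℕ.+ 3 ℕ.* number w))
      W-One : One e (μ ^ a)
      W-One = One-^ e a (q , cong suc (trans X≡ (ℕ.*-comm q e)))
      total : Σ ℕ λ k → power-sum ≡ μ ^ a ℕ.+ e ℕ.* k
      total = Σ<-One e (μ ^ a) (λ n → base (codeword one (λ _ → 0ℤ) n) ^ d)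
        (λ n → One-^ e d (base-One (codeword one (λ _ → 0ℤ) n)))

open FiniteSums
open Geometry using (module Tilings)
open ReedSolomon using (numPoints; unitBound; module Residues; module World)
open import Data.Nat
open import Data.Nat.Properties
open import Data.Nat.DivMod
open import Data.Nat.Divisibility
open import Data.Nat.Tactic.RingSolver using (solve-∀)

-- Injectivity of powers and uniqueness of odd parts.

^-injectiveˡ : ∀ d {x y} → x ^ suc d ≡ y ^ suc d → x ≡ y
^-injectiveˡ d {x} {y} eq with <-cmp x y
... | tri≈ _ x≡y _ = x≡y
... | tri< x<y _ _ = ⊥-elim (<-irrefl eq (^-monoˡ-< (suc d) x<y))
... | tri> _ _ y<x = ⊥-elim (<-irrefl (sym eq) (^-monoˡ-< (suc d) y<x))

odd≢even : ∀ p q → 1 + 2 * p ≢ 2 * q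
odd≢even p q eq = 1+n≢0 (trans (sym (mod2 p 1 (s≤s (s≤s z≤n)))) (trans (cong (_% 2) eq) (mod2 q 0 (s≤s z≤n))))
  where mod2 : ∀ p r → r < 2 → (r + 2 * p) % 2 ≡ r
        mod2 p r r<2 = trans (cong (λ y → (r + y) % 2) (*-comm 2 p)) (trans ([m+kn]%n≡m%n r p 2) (m<n⇒m%n≡m r<2))

odd-part-unique : ∀ g h p q → 2 ^ g * (1 + 2 * p) ≡ 2 ^ h * (1 + 2 * q) → p ≡ q
odd-part-unique zero    zero    p q eq = *-cancelˡ-≡ p q 2 (suc-injective
  (trans (sym (*-identityˡ (1 + 2 * p))) (trans eq (*-identityˡ (1 + 2 * q)))))
odd-part-unique zero    (suc h) p q eq =
  ⊥-elim (odd≢even p (2 ^ h * (1 + 2 * q)) (trans (sym (*-identityˡ (1 + 2 * p))) (trans eq (*-assoc 2 (2 ^ h) _))))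
odd-part-unique (suc g) zero    p q eq =
  ⊥-elim (odd≢even q (2 ^ g * (1 + 2 * p)) (trans (sym (*-identityˡ (1 + 2 * q))) (trans (sym eq) (*-assoc 2 (2 ^ g) _))))
odd-part-unique (suc g) (suc h) p q eq = odd-part-unique g h p q
  (*-cancelˡ-≡ _ _ 2 (trans (sym (*-assoc 2 (2 ^ g) _)) (trans eq (*-assoc 2 (2 ^ h) _))))

-- Blocks over three moduli with a common mean, and the resulting square.

module Assembly (d′ c e L : ℕ) (β≡2^d : suc e ≡ 2 ^ suc d′) (0<e : 0 < e) (X : Fin 3 → ℕ)
  (invertible : ∀ i u → 0 < u → u ≤ unitBound (suc (suc d′)) c → u ∣ X i)
  (e∣X : ∀ i → e ∣ X i) (eL≤μ : ∀ i → e * L ≤ suc (X i)) where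

  d : ℕ
  d = suc d′

  module W (i : Fin 3) = World d c e (toℕ i) (X i) (invertible i)

  μ V : Fin 3 → ℕ
  μ i = suc (X i)
  V i = μ i ^ suc d

  -- Weighting each kind by the product of the other two power sums turns all three into the same
  -- number `mean`.
  cofactor : Fin 3 → ℕ
  cofactor 0F = W.power-sum 1F * W.power-sum 2F
  cofactor 1F = W.power-sum 0F * W.power-sum 2F
  cofactor 2F = W.power-sum 0F * W.power-sum 1F

  mean : ℕ
  mean = W.power-sum 0F * W.power-sum 1F * W.power-sum 2F

  cofactor-* : ∀ i → cofactor i * W.power-sum i ≡ mean
  cofactor-* 0F = lem (W.power-sum 0F) (W.power-sum 1F) (W.power-sum 2F)
    where lem : ∀ p q r → q * r * p ≡ p * q * r
          lem = solve-∀
  cofactor-* 1F = lem (W.power-sum 0F) (W.power-sum 1F) (W.power-sum 2F)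
    where lem : ∀ p q r → p * r * q ≡ p * q * r
          lem = solve-∀
  cofactor-* 2F = refl

  cofactor>0 : ∀ i → 0 < cofactor i
  cofactor>0 0F = *-mono-≤ {1} {_} {1} (W.power-sum>0 1F) (W.power-sum>0 2F)
  cofactor>0 1F = *-mono-≤ {1} {_} {1} (W.power-sum>0 0F) (W.power-sum>0 2F)
  cofactor>0 2F = *-mono-≤ {1} {_} {1} (W.power-sum>0 0F) (W.power-sum>0 1F)

  power-sum-One : ∀ i → One e (W.power-sum i)
  power-sum-One i = W.power-sum-One i (e∣X i)

  cofactor-One : ∀ i → One e (cofactor i)
  cofactor-One 0F = One-* e (power-sum-One 1F) (power-sum-One 2F)
  cofactor-One 1F = One-* e (power-sum-One 0F) (power-sum-One 2F)
  cofactor-One 2F = One-* e (power-sum-One 0F) (power-sum-One 1F)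

  -- With scaling factors of this power sum the blocks of all three kinds have the same mean.
  target : Fin 3 → ℕ
  target i = μ i * (V i * cofactor i)

  μ-One : ∀ i → One e (μ i)
  μ-One i = quotient (e∣X i) , cong suc (trans (_∣_.equality (e∣X i)) (*-comm _ e))

  μ≤target : ∀ i → μ i ≤ target i
  μ≤target i = ≤-trans (≤-reflexive (sym (*-identityʳ (μ i))))
    (*-monoʳ-≤ (μ i) (*-mono-≤ {1} {_} {1} (m^n>0 (μ i) (suc d)) (cofactor>0 i)))

  module Balanced (target< : ∀ i → target i < suc e ^ L) where

    -- One summand for each value of the selecting digit. Both `μ i` and `target i` are 1 modulo
    -- `e`, as `sum-of-powers` needs.
    exponents : ∀ i → Σ (ℕ → ℕ) λ g → Σ< (μ i) (λ u → suc e ^ g u) ≡ target i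
    exponents i = sum-of-powers e L (target i) (μ i) (proj₁ (μ-One i)) (proj₁ target-One)
      (target< i) (eL≤μ i) (μ≤target i)
      (trans (cong (_+ e * proj₁ (μ-One i)) (proj₂ target-One))
        (trans (lem e (proj₁ target-One) (proj₁ (μ-One i))) (cong (_+ e * proj₁ target-One) (sym (proj₂ (μ-One i))))))
      where
      target-One : One e (target i)
      target-One = One-* e (μ-One i) (One-* e (One-^ e (suc d) (μ-One i)) (cofactor-One i))
      lem : ∀ e p q → 1 + e * p + e * q ≡ 1 + e * q + e * p
      lem = solve-∀

    scale : Fin 3 → ℕ → ℕ
    scale i u = 2 ^ proj₁ (exponents i) u

    scale-sum : ∀ i → Σ< (μ i) (λ u → scale i u ^ d) ≡ target i
    scale-sum i = trans (Σ<-ext (μ i) λ u → power (proj₁ (exponents i) u)) (proj₂ (exponents i))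
      where power : ∀ g → (2 ^ g) ^ d ≡ suc e ^ g
            power g = trans (^-*-assoc 2 g d) (trans (cong (2 ^_) (*-comm g d))
              (trans (sym (^-*-assoc 2 d g)) (cong (_^ g) (sym β≡2^d))))

    block : Fin 3 → (r s u v : ℕ) → ℕ
    block i = W.block i (scale i)

    magicSum≡ : ∀ i → W.Sums.magicSum i (scale i) ≡ V i * mean
    magicSum≡ i = *-cancelˡ-≡ _ _ (μ i) (begin
      μ i * W.Sums.magicSum i (scale i)              ≡⟨ W.magicSum-scaled i (scale i) ⟩
      Σ< (μ i) (λ u → scale i u ^ d) * W.power-sum i ≡⟨ cong (_* W.power-sum i) (scale-sum i) ⟩
      μ i * (V i * cofactor i) * W.power-sum i       ≡⟨ lem (μ i) (V i) (cofactor i) (W.power-sum i) ⟩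
      μ i * (V i * (cofactor i * W.power-sum i))     ≡⟨ cong (λ y → μ i * (V i * y)) (cofactor-* i) ⟩
      μ i * (V i * mean)                             ∎)
      where
      open ≡-Reasoning
      lem : ∀ m v c p → m * (v * c) * p ≡ m * (v * (c * p))
      lem = solve-∀

    open Tilings (Fin 3) V d mean block
      (λ i r s u → trans (W.Sums.block-row i (scale i) r s u) (magicSum≡ i))
      (λ i r s v → trans (W.Sums.block-col i (scale i) r s v) (magicSum≡ i))
      (λ i r s → trans (W.Sums.block-diag i (scale i) r s) (magicSum≡ i))
      (λ i r s → trans (W.Sums.block-anti i (scale i) r s) (magicSum≡ i))
      public

    label : Fin 3 → (r s u v : ℕ) → ℕ
    label i r s u v = toℕ i + 3 * W.number i (W.word i r s u v)

    block-form : ∀ i r s u v → Σ ℕ λ g →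
      block i r s u v ≡ 2 ^ g * (1 + 2 * (e * label i r s u v))
    block-form i r s u v = proj₁ (exponents i) k , cong (scale i k *_) (W.base-form i (W.word i r s u v))
      where k = Residues.dg (X i) (W.word i r s u v zero)

    block>0 : ∀ i r s u v → 0 < block i r s u v
    block>0 i r s u v = subst (0 <_) (sym (proj₂ (block-form i r s u v)))
      (*-mono-≤ {1} {_} {1} (m^n>0 2 (proj₁ (block-form i r s u v))) (s≤s z≤n))

    -- The scaling factor is a power of 2 and the base is odd, so the odd part of an entry gives
    -- back its base.
    block-label : ∀ {i j r s u v r′ s′ u′ v′} → block i r s u v ≡ block j r′ s′ u′ v′ →
      label i r s u v ≡ label j r′ s′ u′ v′
    block-label {i} {j} {r} {s} {u} {v} {r′} {s′} {u′} {v′} eq = *-cancelˡ-≡ (label i r s u v) (label j r′ s′ u′ v′) e {{>-nonZero 0<e}}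
      (odd-part-unique (proj₁ B) (proj₁ B′) (e * label i r s u v) (e * label j r′ s′ u′ v′) (trans (sym (proj₂ B)) (trans eq (proj₂ B′))))
      where B = block-form i r s u v
            B′ = block-form j r′ s′ u′ v′

    module Solution {n : ℕ} (n≤ : ∀ i → n ≤ μ i ^ c) (M : Magic n) where

      root : ℕ → ℕ → ℕ
      root = entry (rect M) 0 0

      square : Square n
      square i j = root (toℕ i) (toℕ j) ^ d

      -- Corners lie inside the square, so `c` digits suffice for each coordinate of a corner over
      -- every modulus.
      corner : ∀ i {r u} → r + u < n → r < μ i ^ c
      corner i {r} {u} r+u<n = ≤-trans (≤-trans (s≤s (m≤m+n r u)) r+u<n) (n≤ i)

      label-tag : ∀ (i : Fin 3) r s u v → label i r s u v % 3 ≡ toℕ i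
      label-tag i r s u v = trans (cong (λ y → (toℕ i + y) % 3) (*-comm 3 m))
        (trans ([m+kn]%n≡m%n (toℕ i) m 3) (m<n⇒m%n≡m (Fin.toℕ<n i)))
        where m = W.number i (W.word i r s u v)

      coordinates : ∀ {i j r s u v r′ s′ u′ v′} → i ≡ j → r + u < n → s + v < n → r′ + u′ < n → s′ + v′ < n →
        u < V i → v < V i → u′ < V j → v′ < V j →
        label i r s u v ≡ label j r′ s′ u′ v′ →
        r + u ≡ r′ + u′ × s + v ≡ s′ + v′
      coordinates {i} {r = r} {s} {u} {v} {r′} {s′} {u′} {v′} refl x< y< x′< y′< u< v< u′< v′< eq =
        cong₂ _+_ (proj₁ (proj₁ same)) (proj₁ (proj₂ same)) , cong₂ _+_ (proj₂ (proj₁ same)) (proj₂ (proj₂ same))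
        where
        m = W.number i (W.word i r s u v)
        m′ = W.number i (W.word i r′ s′ u′ v′)
        same = W.number-injective i {r} {s} {u} {v} {r′} {s′} {u′} {v′} (corner i x<) (corner i y<) u< v< (corner i x′<) (corner i y′<) u′< v′<
                       (*-cancelˡ-≡ m m′ 3 (+-cancelˡ-≡ (toℕ i) (3 * m) (3 * m′) eq))

      -- The label modulo 3 reveals the kind of the block; within one kind `number-injective`
      -- recovers corner and offset.
      located-unique : ∀ {x y x′ y′ z} → x < n → y < n → x′ < n → y′ < n →
        Located x y z → Located x′ y′ z → x ≡ x′ × y ≡ y′
      located-unique x< y< x′< y′<
        (located {i} {r} {s} {u} {v} u< v< refl refl eq) (located {j} {r′} {s′} {u′} {v′} u′< v′< refl refl eq′) =
        coordinates {i} {j} {r} {s} {u} {v} {r′} {s′} {u′} {v′}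
          (Fin.toℕ-injective (trans (sym (label-tag i r s u v)) (trans (cong (_% 3) eqₙ) (label-tag j r′ s′ u′ v′))))
          x< y< x′< y′< u< v< u′< v′< eqₙ
        where eqₙ = block-label {i} {j} {r} {s} {u} {v} {r′} {s′} {u′} {v′} (trans (sym eq) eq′)

      located>0 : ∀ {x y z} → Located x y z → 0 < z
      located>0 (located {i} {r} {s} {u} {v} _ _ _ _ eq) = subst (0 <_) (sym eq) (block>0 i r s u v)

      find : ∀ (i j : Fin n) → Located (toℕ i) (toℕ j) (root (toℕ i) (toℕ j))
      find i j = locate (rect M) 0 0 (toℕ i) (toℕ j) (Fin.toℕ<n i) (Fin.toℕ<n j)

      distinct : PairwiseDistinct n square
      distinct i j k l eq = Fin.toℕ-injective (proj₁ same) , Fin.toℕ-injective (proj₂ same)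
        where same = located-unique (Fin.toℕ<n i) (Fin.toℕ<n j) (Fin.toℕ<n k) (Fin.toℕ<n l)
                       (find i j) (subst (Located _ _) (sym (^-injectiveˡ d′ eq)) (find k l))

      root>0 : ∀ (i j : Fin n) → 0 < root (toℕ i) (toℕ j)
      root>0 i j = located>0 (find i j)

      sums : MagicSums n square
      sums = n * mean
        , (λ i → trans (sumFin-toℕ n (λ y → root (toℕ i) y ^ d)) (row-sum (rect M) 0 0 (toℕ i) (Fin.toℕ<n i)))
        , (λ j → trans (sumFin-toℕ n (λ x → root x (toℕ j) ^ d)) (col-sum (rect M) 0 0 (toℕ j) (Fin.toℕ<n j)))
        , trans (sumFin-toℕ n (λ x → root x x ^ d)) (diag M 0 0)
        , trans (sumFin-cong n λ i → cong (λ y → root (toℕ i) y ^ d) (Fin.opposite-prop i))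
            (trans (sumFin-toℕ n (λ x → root x (n ∸ suc x) ^ d)) (anti M 0 0))

      solution : IsMagicSquareOfPowers d n square
      solution = (distinct , (λ i j → m^n>0 _ {{>-nonZero (root>0 i j)}} d) , sums)
               , λ i j → root (toℕ i) (toℕ j) , root>0 i j , refl

-- Bracketing, representation by two sizes, elementary estimates.

bracket : ∀ (f : ℕ → ℕ) n b → f 0 ≤ n → n < f b → Σ ℕ λ z → f z ≤ n × n < f (suc z)
bracket f n zero    f0≤n n<f0 = ⊥-elim (<⇒≱ n<f0 f0≤n)
bracket f n (suc b) f0≤n n<f with f b ≤? n
... | yes fb≤n = b , fb≤n , n<f
... | no  fb≰n = bracket f n b f0≤n (≰⇒> fb≰n)

-- With `x` the remainder of `n` modulo `R`, `x * P` is congruent to `n` modulo `R`, and it is at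
-- most `P * R`, hence at most `n`.
two-sizes : ∀ P R h n → P ≡ 1 + R * h → 0 < R → P * R ≤ n → Σ ℕ λ x → Σ ℕ λ y → n ≡ y * R + x * P
two-sizes P R h n P≡ 0<R PR≤n = x , y , trans n≡ (trans (cong (λ w → x + w * R) (sym (m∸n+n≡m xh≤q)))
    (trans (lem₂ x y R h) (cong (λ w → y * R + x * w) (sym P≡))))
  where
  instance
    R≢0 : NonZero R
    R≢0 = >-nonZero 0<R
  x = n % R
  q = n / R
  n≡ : n ≡ x + q * R
  n≡ = m≡m%n+[m/n]*n n R
  lem₁ : ∀ x R h → x + x * h * R ≡ x * (1 + R * h)
  lem₁ = solve-∀
  lem₂ : ∀ x y R h → x + (y + x * h) * R ≡ y * R + x * (1 + R * h)
  lem₂ = solve-∀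
  xh≤q : x * h ≤ q
  xh≤q = *-cancelʳ-≤ (x * h) q R (+-cancelˡ-≤ x _ _ (begin
    x + x * h * R   ≡⟨ lem₁ x R h ⟩
    x * (1 + R * h) ≡⟨ cong (x *_) (sym P≡) ⟩
    x * P           ≤⟨ *-monoˡ-≤ P (<⇒≤ (m%n<n n R)) ⟩
    R * P           ≡⟨ *-comm R P ⟩
    P * R           ≤⟨ PR≤n ⟩
    n               ≡⟨ n≡ ⟩
    x + q * R       ∎))
    where open ≤-Reasoning
  y = q ∸ x * h

n<2^n : ∀ n → n < 2 ^ n
n<2^n zero    = s≤s z≤n
n<2^n (suc n) = begin-strict
  suc n           ≤⟨ n<2^n n ⟩
  2 ^ n           <⟨ m<m+n (2 ^ n) (m^n>0 2 n) ⟩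
  2 ^ n + 2 ^ n   ≡⟨ cong (2 ^ n +_) (sym (+-identityʳ (2 ^ n))) ⟩
  2 ^ suc n       ∎
  where open ≤-Reasoning

m∣n! : ∀ {m n} → 0 < m → m ≤ n → m ∣ n !
m∣n! {suc m} _ m≤n = ∣-trans (m∣m*n (m !)) (m≤n⇒m!∣n! m≤n)

-- Choice of the constants and of the moduli.

module Constants (d′ : ℕ) where

  d a e f c T U h C K : ℕ
  d = suc (suc d′)
  a = suc d
  e = pred (2 ^ d)
  -- every modulus is at most μ₀ ^ f, and the sizes up to the next choice of moduli are at most μ₀ ^ c
  f = 2 + ((1 + a) * a + a)
  c = 2 * (f * a + f)
  T = numPoints a c
  U = unitBound a c
  -- power sums are at most μ ^ h, the target sums of scaling factors at most μ₀ ^ C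
  h = a + suc T * d
  C = f + (f * a + (f * h + f * h))
  -- The factor `U !` makes all positive integers up to `U` divide each `X i`; the other factor
  -- makes `w` large enough for `6e≤F` and `μ₀<`.
  K = U ! * (6 * (1 + e * C))

  β≡2^d : suc e ≡ 2 ^ d
  β≡2^d = suc-pred (2 ^ d) {{m^n≢0 2 d}}

  0<e : 0 < e
  0<e = ≤-pred (subst (2 ≤_) (sym β≡2^d) (*-mono-≤ {2} {2} {1} ≤-refl (m^n>0 2 (suc d′))))

  0<K : 0 < K
  0<K = *-mono-≤ {1} {_} {1} (1≤n! U) (s≤s z≤n)

  module Moduli (z′ : ℕ) where

    w L F V₀ V₁ Q X₂ V₂ : ℕ
    -- `μ₀` is below `2 ^ (d * w)`, so `L = C * w` digits in base `2 ^ d` suffice for the targets,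
    -- while `F = e * L` gives each modulus the size demanded by `sum-of-powers`.
    w = K * suc z′
    L = C * w
    F = e * L
    V₀ = suc F ^ a
    -- Putting the earlier sides into the next modulus minus one makes `V₁` 1 modulo `V₀`, and `V₂`
    -- 1 modulo `Q + Q`.
    V₁ = suc (F * V₀) ^ a
    Q = V₁ * V₀
    X₂ = F * (Q + Q)
    V₂ = suc X₂ ^ a

    X : Fin 3 → ℕ
    X 0F = F
    X 1F = F * V₀
    X 2F = X₂

    μ₀ : ℕ
    μ₀ = suc F

    0<V₀ : 0 < V₀
    0<V₀ = m^n>0 μ₀ a

    0<Q : 0 < Q
    0<Q = *-mono-≤ {1} {_} {1} (m^n>0 (suc (F * V₀)) a) 0<V₀

    K≤w : K ≤ w
    K≤w = m≤m*n K (suc z′)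

    0<w : 0 < w
    0<w = ≤-trans 0<K K≤w

    big : 6 * (1 + e * C) ≤ w
    big = ≤-trans (m≤n*m (6 * (1 + e * C)) (U !) {{U !≢0}}) K≤w

    6e≤F : 6 * e ≤ F
    6e≤F = begin
      6 * e       ≡⟨ *-comm 6 e ⟩
      e * 6       ≤⟨ *-monoʳ-≤ e (≤-trans (m≤m*n 6 (1 + e * C)) (≤-trans big (m≤n*m w C))) ⟩
      e * (C * w) ∎
      where open ≤-Reasoning

    2≤μ₀ : 2 ≤ μ₀
    2≤μ₀ = s≤s (≤-trans (≤-trans 0<e (m≤n*m e 6)) 6e≤F)

    F∣X : ∀ i → F ∣ X i
    F∣X 0F = ∣-refl
    F∣X 1F = m∣m*n V₀
    F∣X 2F = m∣m*n (Q + Q)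

    F≤X : ∀ i → F ≤ X i
    F≤X 0F = ≤-refl
    F≤X 1F = m≤m*n F V₀ {{>-nonZero 0<V₀}}
    F≤X 2F = m≤m*n F (Q + Q) {{>-nonZero (≤-trans 0<Q (m≤m+n Q Q))}}

    e∣X : ∀ i → e ∣ X i
    e∣X i = ∣-trans (m∣m*n L) (F∣X i)

    invertible : ∀ i u → 0 < u → u ≤ U → u ∣ X i
    invertible i u 0<u u≤U = ∣-trans (m∣n! 0<u u≤U) (∣-trans (m∣m*n (6 * (1 + e * C)))
      (∣-trans (m∣m*n (suc z′)) (∣-trans (n∣m*n C) (∣-trans (n∣m*n e) (F∣X i)))))

    eL≤μ : ∀ i → e * L ≤ suc (X i)
    eL≤μ i = m≤n⇒m≤1+n (F≤X i)

    open Assembly (suc d′) c e L β≡2^d 0<e X invertible e∣X eL≤μ hiding (d)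

    μ₀-mono : ∀ {k l} → k ≤ l → μ₀ ^ k ≤ μ₀ ^ l
    μ₀-mono = ^-monoʳ-≤ μ₀

    V₁≤ : V₁ ≤ μ₀ ^ ((1 + a) * a)
    V₁≤ = ≤-trans (^-monoˡ-≤ a (+-monoˡ-≤ (F * V₀) 0<V₀)) (≤-reflexive (^-*-assoc μ₀ (1 + a) a))

    Q+Q≤ : Q + Q ≤ μ₀ ^ (1 + ((1 + a) * a + a))
    Q+Q≤ = begin
      Q + Q                                     ≡⟨ cong (Q +_) (sym (+-identityʳ Q)) ⟩
      2 * Q                                     ≤⟨ *-mono-≤ 2≤μ₀ (*-monoˡ-≤ V₀ V₁≤) ⟩
      μ₀ * (μ₀ ^ ((1 + a) * a) * μ₀ ^ a)        ≡⟨ cong (μ₀ *_) (sym (^-distribˡ-+-* μ₀ ((1 + a) * a) a)) ⟩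
      μ₀ ^ (1 + ((1 + a) * a + a))              ∎
      where open ≤-Reasoning

    μ≤ : ∀ i → μ i ≤ μ₀ ^ f
    μ≤ 0F = ≤-trans (≤-reflexive (sym (*-identityʳ μ₀))) (μ₀-mono {1} {f} (s≤s z≤n))
    μ≤ 1F = ≤-trans (+-monoˡ-≤ (F * V₀) 0<V₀) (μ₀-mono (s≤s (m≤n⇒m≤1+n (m≤n+m a ((1 + a) * a)))))
    μ≤ 2F = ≤-trans (+-monoˡ-≤ (F * (Q + Q)) (≤-trans 0<Q (m≤m+n Q Q))) (*-monoʳ-≤ μ₀ Q+Q≤)

    μ-pow≤ : ∀ i k → μ i ^ k ≤ μ₀ ^ (f * k)
    μ-pow≤ i k = ≤-trans (^-monoˡ-≤ k (μ≤ i)) (≤-reflexive (^-*-assoc μ₀ f k))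

    power-sum≤ : ∀ i → W.power-sum i ≤ μ₀ ^ (f * h)
    power-sum≤ i = ≤-trans (W.power-sum≤ i 0<e (≤-pred (Fin.toℕ<n i)) (≤-trans 6e≤F (eL≤μ i))) (μ-pow≤ i h)

    product≤ : ∀ {x y} k l → x ≤ μ₀ ^ k → y ≤ μ₀ ^ l → x * y ≤ μ₀ ^ (k + l)
    product≤ k l x≤ y≤ = ≤-trans (*-mono-≤ x≤ y≤) (≤-reflexive (sym (^-distribˡ-+-* μ₀ k l)))

    cofactor≤ : ∀ i → cofactor i ≤ μ₀ ^ (f * h + f * h)
    cofactor≤ 0F = product≤ (f * h) (f * h) (power-sum≤ 1F) (power-sum≤ 2F)
    cofactor≤ 1F = product≤ (f * h) (f * h) (power-sum≤ 0F) (power-sum≤ 2F)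
    cofactor≤ 2F = product≤ (f * h) (f * h) (power-sum≤ 0F) (power-sum≤ 1F)

    target≤ : ∀ i → target i ≤ μ₀ ^ C
    target≤ i = product≤ f (f * a + (f * h + f * h)) (μ≤ i)
      (product≤ (f * a) (f * h + f * h) (μ-pow≤ i a) (cofactor≤ i))

    -- As `w` is at least `1 + e * C`, `μ₀` is at most the square of `w`, whereas the right side is
    -- exponential in `w`.
    μ₀< : μ₀ < 2 ^ (d * w)
    μ₀< = begin-strict
      1 + e * (C * w)     ≡⟨ cong suc (sym (*-assoc e C w)) ⟩
      1 + e * C * w       ≤⟨ +-monoˡ-≤ (e * C * w) 0<w ⟩
      (1 + e * C) * w     ≤⟨ *-monoˡ-≤ w (≤-trans (m≤n*m (1 + e * C) 6) big) ⟩
      w * w               <⟨ *-mono-< (n<2^n w) (n<2^n w) ⟩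
      2 ^ w * 2 ^ w       ≡⟨ sym (^-distribˡ-+-* 2 w w) ⟩
      2 ^ (w + w)         ≤⟨ ^-monoʳ-≤ 2 (+-monoʳ-≤ w (m≤m+n w (d′ * w))) ⟩
      2 ^ (d * w)         ∎
      where open ≤-Reasoning

    target< : ∀ i → target i < suc e ^ L
    target< i = begin-strict
      target i            ≤⟨ target≤ i ⟩
      μ₀ ^ C              <⟨ ^-monoˡ-< C μ₀< ⟩
      (2 ^ (d * w)) ^ C   ≡⟨ cong (_^ C) (sym (^-*-assoc 2 d w)) ⟩
      ((2 ^ d) ^ w) ^ C   ≡⟨ ^-*-assoc (2 ^ d) w C ⟩
      (2 ^ d) ^ (w * C)   ≡⟨ cong₂ _^_ (sym β≡2^d) (*-comm w C) ⟩
      suc e ^ L           ∎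
      where open ≤-Reasoning

    open Balanced target<

    -- The threshold from which `two-sizes` applies to `V₂` and `Q + Q`.
    size : ℕ
    size = V₂ * (Q + Q)

    size≤ : size ≤ μ₀ ^ (f * a + f)
    size≤ = product≤ (f * a) f (μ-pow≤ 2F a) (≤-trans Q+Q≤ (μ₀-mono (n≤1+n (1 + ((1 + a) * a + a)))))

    μ₀≤μ : ∀ i → μ₀ ≤ μ i
    μ₀≤μ i = s≤s (F≤X i)

    V₁≤V₂ : V₁ ≤ V₂
    V₁≤V₂ = ^-monoˡ-≤ a (s≤s (*-monoʳ-≤ F (≤-trans (m≤n*m V₀ V₁ {{>-nonZero (m^n>0 (suc (F * V₀)) a)}}) (m≤m+n Q Q))))

    V₁-One : One V₀ V₁
    V₁-One = One-^ V₀ a (F , cong suc (*-comm F V₀))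

    V₂-One : One (Q + Q) V₂
    V₂-One = One-^ (Q + Q) a (F , cong suc (*-comm F (Q + Q)))

    -- Both sides are 1 modulo `V₀`, and `V₁≤V₂` makes the difference of the quotients a natural
    -- number.
    complement : Σ ℕ λ β → V₂ ≡ V₁ + β * V₀
    complement = p′ ∸ p , (begin
      V₂                           ≡⟨ V₂≡ ⟩
      1 + V₀ * p′                  ≡⟨ cong (λ y → 1 + V₀ * y) (sym (m+[n∸m]≡n p≤p′)) ⟩
      1 + V₀ * (p + (p′ ∸ p))      ≡⟨ lem₂ V₀ p (p′ ∸ p) ⟩
      1 + V₀ * p + (p′ ∸ p) * V₀   ≡⟨ cong (_+ (p′ ∸ p) * V₀) (sym (proj₂ V₁-One)) ⟩
      V₁ + (p′ ∸ p) * V₀           ∎)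
      where
      open ≡-Reasoning
      p = proj₁ V₁-One
      p′ = (V₁ + V₁) * proj₁ V₂-One
      lem : ∀ v v₁ k → 1 + (v₁ * v + v₁ * v) * k ≡ 1 + v * ((v₁ + v₁) * k)
      lem = solve-∀
      lem₂ : ∀ v p q → 1 + v * (p + q) ≡ 1 + v * p + q * v
      lem₂ = solve-∀
      V₂≡ : V₂ ≡ 1 + V₀ * p′
      V₂≡ = trans (proj₂ V₂-One) (lem V₀ V₁ (proj₁ V₂-One))
      p≤p′ : p ≤ p′
      p≤p′ = *-cancelˡ-≤ V₀ {{>-nonZero 0<V₀}} (≤-pred (subst₂ _≤_ (proj₂ V₁-One) V₂≡ V₁≤V₂))

    construct : ∀ n → size ≤ n → n ≤ μ₀ ^ c → Σ (Square n) λ A → IsMagicSquareOfPowers d n A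
    construct n size≤n n≤ = Solution.square bound M , Solution.solution bound M
      where
      bound : ∀ i → n ≤ μ i ^ c
      bound i = ≤-trans n≤ (^-monoˡ-≤ c (μ₀≤μ i))
      xy = two-sizes V₂ (Q + Q) (proj₁ V₂-One) n (proj₂ V₂-One) (≤-trans 0<Q (m≤m+n Q Q)) size≤n
      x = proj₁ xy
      y = proj₁ (proj₂ xy)
      M : Magic n
      M = subst Magic (sym (proj₂ (proj₂ xy))) (layers 0F 1F 2F (proj₁ complement) (proj₂ complement) x y)

  open Moduli using (size; μ₀)

  -- The admissible ranges for consecutive `z` leave no gap: `F` is linear in `suc z`, so
  -- `μ₀ (suc z)` is at most the square of `μ₀ z`. Hence the factor 2 in `c`.
  next : ∀ z n → n < size (suc z) → n ≤ μ₀ z ^ c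
  next z n n< = begin
    n                              ≤⟨ <⇒≤ n< ⟩
    size (suc z)                   ≤⟨ Moduli.size≤ (suc z) ⟩
    μ₀ (suc z) ^ (f * a + f)       ≤⟨ ^-monoˡ-≤ (f * a + f) step ⟩
    (μ₀ z ^ 2) ^ (f * a + f)       ≡⟨ ^-*-assoc (μ₀ z) 2 (f * a + f) ⟩
    μ₀ z ^ c                       ∎
    where
    open ≤-Reasoning
    E = e * (C * K)
    lem₁ : ∀ e C K z → 1 + e * (C * (K * (2 + z))) ≡ 1 + (e * (C * K)) * (2 + z)
    lem₁ = solve-∀
    lem₂ : ∀ E z → 1 + E * (2 + z) + (E * z + (E * (1 + z)) * (E * (1 + z))) ≡ (1 + E * (1 + z)) * ((1 + E * (1 + z)) * 1)
    lem₂ = solve-∀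
    lem₃ : ∀ e C K z → (1 + (e * (C * K)) * (1 + z)) ≡ 1 + e * (C * (K * (1 + z)))
    lem₃ = solve-∀
    step : μ₀ (suc z) ≤ μ₀ z ^ 2
    step = begin
      1 + e * (C * (K * (2 + z)))                                       ≡⟨ lem₁ e C K z ⟩
      1 + E * (2 + z)                                                   ≤⟨ m≤m+n _ _ ⟩
      1 + E * (2 + z) + (E * z + (E * (1 + z)) * (E * (1 + z)))         ≡⟨ lem₂ E z ⟩
      (1 + E * (1 + z)) ^ 2                                             ≡⟨ cong (_^ 2) (lem₃ e C K z) ⟩
      μ₀ z ^ 2                                                          ∎

  -- A crude bound that gives `bracket` its upper index and makes the threshold positive.
  size> : ∀ z → z < size z
  size> z = begin-strict
    z               <⟨ n<1+n z ⟩
    suc z           ≤⟨ m≤n*m (suc z) K {{>-nonZero 0<K}} ⟩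
    w               ≤⟨ m≤n*m w C ⟩
    L               ≤⟨ m≤n*m L e {{>-nonZero 0<e}} ⟩
    F               ≤⟨ m≤n⇒m≤1+n (F≤X 2F) ⟩
    suc X₂          ≤⟨ m≤m*n (suc X₂) (suc X₂ ^ d) {{m^n≢0 (suc X₂) d}} ⟩
    V₂              ≤⟨ m≤m*n V₂ (Q + Q) {{>-nonZero (≤-trans 0<Q (m≤m+n Q Q))}} ⟩
    V₂ * (Q + Q)    ∎
    where
    open ≤-Reasoning
    open Moduli z using (w; L; F; X₂; V₂; Q; F≤X; 0<Q)

theorem1p3 : (d : ℕ) → 3 ≤ d →
    Σ ℕ λ n₀ → (0 < n₀) ×
    ((n : ℕ) → n₀ ≤ n → Σ (Square n) λ A → IsMagicSquareOfPowers d n A)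
theorem1p3 1 (s≤s ())
theorem1p3 (suc (suc d′)) _ = size 0 , size> 0 , λ n size≤n →
  -- Since `size n` exceeds `n`, some index below `n` has an admissible range containing `n`.
  let z , size≤ , n< = bracket size n n size≤n (size> n)
  in construct z n size≤ (next z n n<)
  where
  open Constants d′
  open Moduli using (size; construct)
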